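{- For every $n\ge 1$ the genus distribution of the Ringel ladder $RL_n$ is unimodal, and its peak $p_{RL}(n)$ is $$p_{RL}(n)=\begin{cases}\Big[\dfrac{n+1}{2}\Big], & 1\le n\le 6,\\[2mm] 3, & n=7,\\[1mm] \Big[\dfrac{n+2}{3}\Big]+1, & n\ge 8.\end{cases}$$
   Context: $[x]$ denotes the largest integer not exceeding $x$. The Ringel ladder $RL_n$ is the cubic graph with vertices $u_1,\dots,u_n,v_1,\dots,v_n,w,w'$ and edges $u_lu_{l+1}$, $v_lv_{l+1}$ ($1\le l\le n-1$), $u_lv_l$ ($1\le l\le n$), $wu_1$, $wv_1$, $w'u_n$, $w'v_n$ and $ww'$ (that is, the closed-end ladder with $n$ rungs whose two end edges are subdivided and the subdividing vertices joined by an edge). For a graph $G$, $g_i(G)$ is the number of 2-cell embeddings of $G$ on the orientable surface of genus $i$ (embeddings counted as rotation systems), and the genus distribution of $G$ is the sequence $g_\gamma(G),g_{\gamma+1}(G),\dots,g_{\gamma_M}(G)$ with $\gamma,\gamma_M$ the minimum and maximum genus of $G$. A finite sequence of nonnegative numbers $\{a_i\}_{i=q}^n$ is unimodal if $a_q\le\cdots\le a_{l-1}<a_l=\cdots=a_m>a_{m+1}\ge\cdots\ge a_n$ for some $q\le l\le m\le n$; if $l=m$, then $m$ is called the peak (indices are genera). -}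

module Defs where

open import Data.Bool.Base using (if_then_else_)
open import Data.Fin.Base using (Fin; zero; suc; toℕ; inject₁; fromℕ)
import Data.Fin.Properties as Fin
open import Data.Fin.Induction using (<-weakInduction)
open import Data.Fin.Relation.Unary.Top using (view; ‵fromℕ; ‵inject₁)
open import Data.List.Base
  using (List; []; _∷_; _++_; map; concatMap; cartesianProductWith; filter;
         deduplicate; iterate; length; allFin)
open import Data.List.Membership.Propositional using (_∈_; _∉_)
open import Data.List.Membership.Propositional.Properties
  using (∈-map⁺; ∈-map⁻; ∈-++⁺ˡ; ∈-++⁺ʳ; ∈-++⁻; ∈-allFin)
import Data.List.Membership.DecPropositional as DecMembership
open import Data.List.Relation.Unary.All using ([]; _∷_)
open import Data.List.Relation.Unary.AllPairs using ([]; _∷_)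
open import Data.List.Relation.Unary.Any using (here; there)
open import Data.List.Relation.Unary.Unique.Propositional using (Unique)
import Data.List.Relation.Unary.Unique.Propositional.Properties as Unique
open import Data.Nat.Base
  using (ℕ; suc; _+_; _*_; _/_; _≤_; _<_; _≤ᵇ_; _≡ᵇ_; NonZero)
import Data.Nat.Properties as ℕ
open import Data.Product.Base using (_×_; _,_; ∃₂)
open import Data.Product.Properties using (≡-dec)
open import Data.Sum.Base using (inj₁; inj₂)
open import Function.Base using (const)
open import Relation.Binary.Construct.Closure.ReflexiveTransitive
  using (Star; ε; _◅_; _◅◅_; reverse)
open import Relation.Binary.Construct.Closure.Symmetric
  using (SymClosure; fwd; bwd; symmetric)
open import Relation.Binary.Definitions using (DecidableEquality)
open import Relation.Binary.PropositionalEquality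
  using (_≡_; _≢_; refl; sym; trans; cong)
open import Relation.Nullary using (¬_; Dec; yes; no; does; contradiction)
open import Relation.Nullary.Decidable using (map′)

-- The lists `vertices` and `neighbours x` only enumerate finite sets; their
-- order carries no information.
record Graph : Set₁ where
  infix 4 _≟_ _~_
  field
    Vertex            : Set
    _≟_               : DecidableEquality Vertex
    vertices          : List Vertex
    vertices-complete : ∀ x → x ∈ vertices
    vertices-unique   : Unique vertices

    _~_       : Vertex → Vertex → Set
    ~-sym     : ∀ {x y} → x ~ y → y ~ x
    ~-irrefl  : ∀ {x} → ¬ (x ~ x)
    connected : ∀ x y → Star _~_ x y

    neighbours          : Vertex → List Vertex
    neighbours-sound    : ∀ {x y} → y ∈ neighbours x → x ~ y
    neighbours-complete : ∀ {x y} → x ~ y → y ∈ neighbours x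
    neighbours-unique   : ∀ x → Unique (neighbours x)

module _ {A : Set} where

  insertions : A → List A → List (List A)
  insertions x []       = (x ∷ []) ∷ []
  insertions x (y ∷ ys) = (x ∷ y ∷ ys) ∷ map (y ∷_) (insertions x ys)

  permutations : List A → List (List A)
  permutations []       = [] ∷ []
  permutations (x ∷ xs) = concatMap (insertions x) (permutations xs)

  -- A list without repetitions is read as the cyclic order in which each
  -- entry is followed by the next one and the last entry by the first.
  -- Rotating such a list does not change the cyclic order, so every cyclic
  -- order of a nonempty set arises exactly once with a prescribed first entry.
  cyclicOrders : List A → List (List A)
  cyclicOrders []       = [] ∷ []
  cyclicOrders (x ∷ xs) = map (x ∷_) (permutations xs)

  module _ (_≟_ : DecidableEquality A) where

    cyclicSuccessor : List A → A → A
    cyclicSuccessor []       a = a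
    cyclicSuccessor (x ∷ xs) a = go x xs
      where
      go : A → List A → A
      go y []       = x
      go y (z ∷ zs) = if does (a ≟ y) then z else go z zs

module _ (G : Graph) where
  open Graph G

  RotationSystem : Set
  RotationSystem = Vertex → List Vertex

  assign : Vertex → List Vertex → RotationSystem → RotationSystem
  assign x c ρ y = if does (x ≟ y) then c else ρ y

  -- The initial value `const []` is overwritten at every listed vertex.
  rotationSystemsOn : List Vertex → List RotationSystem
  rotationSystemsOn []       = const [] ∷ []
  rotationSystemsOn (x ∷ xs) =
    cartesianProductWith (assign x) (cyclicOrders (neighbours x))
                                    (rotationSystemsOn xs)

  rotationSystems : List RotationSystem
  rotationSystems = rotationSystemsOn vertices

  -- (x , y) is the edge xy traversed from x to y.
  Dart : Set
  Dart = Vertex × Vertex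

  darts : List Dart
  darts = concatMap (λ x → map (x ,_) (neighbours x)) vertices

  open DecMembership (≡-dec _≟_ _≟_) using (_∈?_)

  -- Face tracing: on arriving at y from x, leave along the edge that follows
  -- yx in the rotation at y.  The faces are the orbits of this permutation of
  -- the darts, and an orbit has at most `length darts` elements.
  traceStep : RotationSystem → Dart → Dart
  traceStep ρ (x , y) = y , cyclicSuccessor _≟_ (ρ y) x

  faceOf : RotationSystem → Dart → List Dart
  faceOf ρ d = iterate (traceStep ρ) d (length darts)

  -- One dart per face.
  faces : RotationSystem → List Dart
  faces ρ = deduplicate (λ d e → e ∈? faceOf ρ d) darts

  vertexCount edgeCount : ℕ
  vertexCount = length vertices
  edgeCount   = length darts / 2

  faceCount : RotationSystem → ℕ
  faceCount ρ = length (faces ρ)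

  -- Euler's formula V - E + F = 2 - 2i, arranged so as to avoid subtraction.
  HasGenus : ℕ → RotationSystem → Set
  HasGenus i ρ = vertexCount + faceCount ρ + 2 * i ≡ edgeCount + 2

  hasGenus? : ∀ i ρ → Dec (HasGenus i ρ)
  hasGenus? i ρ = _ ℕ.≟ _

  genusCount : ℕ → ℕ
  genusCount i = length (filter (hasGenus? i) rotationSystems)

  IsMinimumGenus : ℕ → Set
  IsMinimumGenus γ = 0 < genusCount γ × (∀ i → 0 < genusCount i → γ ≤ i)

  IsMaximumGenus : ℕ → Set
  IsMaximumGenus γ = 0 < genusCount γ × (∀ i → 0 < genusCount i → i ≤ γ)

-- a q ≤ ⋯ ≤ a (l - 1) < a l = ⋯ = a m > a (m + 1) ≥ ⋯ ≥ a n
record UnimodalAt (a : ℕ → ℕ) (q n l m : ℕ) : Set where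
  field
    q≤l        : q ≤ l
    l≤m        : l ≤ m
    m≤n        : m ≤ n
    ascending  : ∀ i → q ≤ i → suc i < l → a i ≤ a (suc i)
    rise       : ∀ i → q ≤ i → suc i ≡ l → a i < a l
    plateau    : ∀ i → l ≤ i → i ≤ m → a i ≡ a m
    fall       : suc m ≤ n → a (suc m) < a m
    descending : ∀ i → suc m ≤ i → suc i ≤ n → a (suc i) ≤ a i

Unimodal : (a : ℕ → ℕ) (q n : ℕ) → Set
Unimodal a q n = ∃₂ λ l m → UnimodalAt a q n l m

IsPeak : (a : ℕ → ℕ) (q n p : ℕ) → Set
IsPeak a q n p = UnimodalAt a q n p p

-- u i and v i stand for the vertices with subscript i + 1.
data RLVertex (n : ℕ) : Set where
  u v  : Fin n → RLVertex n
  w w′ : RLVertex n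

data RLEdge {n : ℕ} : RLVertex n → RLVertex n → Set where
  uu  : ∀ {i j} → toℕ j ≡ suc (toℕ i) → RLEdge (u i) (u j)
  vv  : ∀ {i j} → toℕ j ≡ suc (toℕ i) → RLEdge (v i) (v j)
  uv  : ∀ {i} → RLEdge (u i) (v i)
  wu  : ∀ {i} → toℕ i ≡ 0 → RLEdge w (u i)
  wv  : ∀ {i} → toℕ i ≡ 0 → RLEdge w (v i)
  w′u : ∀ {i} → suc (toℕ i) ≡ n → RLEdge w′ (u i)
  w′v : ∀ {i} → suc (toℕ i) ≡ n → RLEdge w′ (v i)
  ww′ : RLEdge w w′

RLAdjacent : ∀ {n} → RLVertex n → RLVertex n → Set
RLAdjacent = SymClosure RLEdge

module _ {n : ℕ} where

  u-injective : ∀ {i j : Fin n} → u i ≡ u j → i ≡ j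
  u-injective refl = refl

  v-injective : ∀ {i j : Fin n} → v i ≡ v j → i ≡ j
  v-injective refl = refl

  _≟ᴿ_ : DecidableEquality (RLVertex n)
  u i ≟ᴿ u j = map′ (cong u) u-injective (i Fin.≟ j)
  u i ≟ᴿ v j = no λ ()
  u i ≟ᴿ w   = no λ ()
  u i ≟ᴿ w′  = no λ ()
  v i ≟ᴿ u j = no λ ()
  v i ≟ᴿ v j = map′ (cong v) v-injective (i Fin.≟ j)
  v i ≟ᴿ w   = no λ ()
  v i ≟ᴿ w′  = no λ ()
  w   ≟ᴿ u j = no λ ()
  w   ≟ᴿ v j = no λ ()
  w   ≟ᴿ w   = yes refl
  w   ≟ᴿ w′  = no λ ()
  w′  ≟ᴿ u j = no λ ()
  w′  ≟ᴿ v j = no λ ()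
  w′  ≟ᴿ w   = no λ ()
  w′  ≟ᴿ w′  = yes refl

  vs-ws us-vs-ws : List (RLVertex n)
  vs-ws    = map v (allFin n) ++ w ∷ w′ ∷ []
  us-vs-ws = map u (allFin n) ++ vs-ws

  us-vs-ws-complete : ∀ x → x ∈ us-vs-ws
  us-vs-ws-complete (u i) = ∈-++⁺ˡ (∈-map⁺ u (∈-allFin i))
  us-vs-ws-complete (v i) =
    ∈-++⁺ʳ (map u (allFin n)) (∈-++⁺ˡ (∈-map⁺ v (∈-allFin i)))
  us-vs-ws-complete w     =
    ∈-++⁺ʳ (map u (allFin n)) (∈-++⁺ʳ (map v (allFin n)) (here refl))
  us-vs-ws-complete w′    =
    ∈-++⁺ʳ (map u (allFin n)) (∈-++⁺ʳ (map v (allFin n)) (there (here refl)))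

  v∉ws : ∀ {i : Fin n} → v i ∉ w ∷ w′ ∷ []
  v∉ws (here ())
  v∉ws (there (here ()))

  u∉vs-ws : ∀ {i} → u i ∉ vs-ws
  u∉vs-ws p with ∈-++⁻ (map v (allFin n)) p
  ... | inj₁ q with ∈-map⁻ v q
  ...   | _ , _ , ()
  u∉vs-ws p | inj₂ (here ())
  u∉vs-ws p | inj₂ (there (here ()))

  us-vs-ws-unique : Unique us-vs-ws
  us-vs-ws-unique =
    Unique.++⁺ (Unique.map⁺ u-injective (Unique.allFin⁺ n))
      (Unique.++⁺ (Unique.map⁺ v-injective (Unique.allFin⁺ n))
        (((λ ()) ∷ []) ∷ [] ∷ []) v-disjoint) u-disjoint
    where
    v-disjoint : ∀ {x : RLVertex n} → ¬ (x ∈ map v (allFin n) × x ∈ w ∷ w′ ∷ [])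
    v-disjoint (p , q) with ∈-map⁻ v p
    ... | _ , _ , refl = v∉ws q

    u-disjoint : ∀ {x} → ¬ (x ∈ map u (allFin n) × x ∈ vs-ws)
    u-disjoint (p , q) with ∈-map⁻ u p
    ... | _ , _ , refl = u∉vs-ws q

  RL-irrefl : ∀ {x : RLVertex n} → ¬ RLAdjacent x x
  RL-irrefl (fwd (uu p)) = ℕ.1+n≢n (sym p)
  RL-irrefl (fwd (vv p)) = ℕ.1+n≢n (sym p)
  RL-irrefl (bwd (uu p)) = ℕ.1+n≢n (sym p)
  RL-irrefl (bwd (vv p)) = ℕ.1+n≢n (sym p)

module _ {m : ℕ} where

  private
    V = RLVertex (suc m)

  u⇝w : ∀ i → Star RLAdjacent (u {suc m} i) w
  u⇝w = <-weakInduction (λ i → Star RLAdjacent (u i) w)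
    (bwd (wu refl) ◅ ε)
    (λ i p → bwd (uu (cong suc (sym (Fin.toℕ-inject₁ i)))) ◅ p)

  x⇝w : ∀ (x : V) → Star RLAdjacent x w
  x⇝w (u i) = u⇝w i
  x⇝w (v i) = bwd uv ◅ u⇝w i
  x⇝w w     = ε
  x⇝w w′    = bwd ww′ ◅ ε

  RL-connected : ∀ (x y : V) → Star RLAdjacent x y
  RL-connected x y = x⇝w x ◅◅ reverse (symmetric RLEdge) (x⇝w y)

  -- The neighbours of s i other than the one on its rung, for s = u or s = v.
  before after : (Fin (suc m) → V) → Fin (suc m) → V
  before s zero    = w
  before s (suc i) = s (inject₁ i)
  after s i with view i
  ... | ‵fromℕ     = w′
  ... | ‵inject₁ j = s (suc j)

  RL-neighbours : V → List V
  RL-neighbours (u i) = before u i ∷ after u i ∷ v i ∷ []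
  RL-neighbours (v i) = before v i ∷ after v i ∷ u i ∷ []
  RL-neighbours w     = u zero ∷ v zero ∷ w′ ∷ []
  RL-neighbours w′    = u (fromℕ m) ∷ v (fromℕ m) ∷ w ∷ []

  before-sound-u : ∀ i → RLAdjacent (u i) (before u i)
  before-sound-u zero    = bwd (wu refl)
  before-sound-u (suc i) = bwd (uu (cong suc (sym (Fin.toℕ-inject₁ i))))

  before-sound-v : ∀ i → RLAdjacent (v i) (before v i)
  before-sound-v zero    = bwd (wv refl)
  before-sound-v (suc i) = bwd (vv (cong suc (sym (Fin.toℕ-inject₁ i))))

  after-sound-u : ∀ i → RLAdjacent (u i) (after u i)
  after-sound-u i with view i
  ... | ‵fromℕ     = bwd (w′u (cong suc (Fin.toℕ-fromℕ m)))
  ... | ‵inject₁ j = fwd (uu (cong suc (sym (Fin.toℕ-inject₁ j))))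

  after-sound-v : ∀ i → RLAdjacent (v i) (after v i)
  after-sound-v i with view i
  ... | ‵fromℕ     = bwd (w′v (cong suc (Fin.toℕ-fromℕ m)))
  ... | ‵inject₁ j = fwd (vv (cong suc (sym (Fin.toℕ-inject₁ j))))

  RL-neighbours-sound : ∀ {x y : V} → y ∈ RL-neighbours x → RLAdjacent x y
  RL-neighbours-sound {u i} (here refl)                 = before-sound-u i
  RL-neighbours-sound {u i} (there (here refl))         = after-sound-u i
  RL-neighbours-sound {u i} (there (there (here refl))) = fwd uv
  RL-neighbours-sound {v i} (here refl)                 = before-sound-v i
  RL-neighbours-sound {v i} (there (here refl))         = after-sound-v i
  RL-neighbours-sound {v i} (there (there (here refl))) = bwd uv
  RL-neighbours-sound {w}   (here refl)                 = fwd (wu refl)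
  RL-neighbours-sound {w}   (there (here refl))         = fwd (wv refl)
  RL-neighbours-sound {w}   (there (there (here refl))) = fwd ww′
  RL-neighbours-sound {w′}  (here refl)                 =
    fwd (w′u (cong suc (Fin.toℕ-fromℕ m)))
  RL-neighbours-sound {w′}  (there (here refl))         =
    fwd (w′v (cong suc (Fin.toℕ-fromℕ m)))
  RL-neighbours-sound {w′}  (there (there (here refl))) = bwd ww′

  first : ∀ {i : Fin (suc m)} → toℕ i ≡ 0 → i ≡ zero
  first p = Fin.toℕ-injective p

  last : ∀ {i : Fin (suc m)} → suc (toℕ i) ≡ suc m → i ≡ fromℕ m
  last p = Fin.toℕ-injective (trans (ℕ.suc-injective p) (sym (Fin.toℕ-fromℕ m)))

  before-first : ∀ s {i} → toℕ i ≡ 0 → w ≡ before s i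
  before-first s {zero} p = refl

  before-step : ∀ s {i j} → toℕ j ≡ suc (toℕ i) → s i ≡ before s j
  before-step s {j = suc j} p = cong s (Fin.toℕ-injective
    (trans (sym (ℕ.suc-injective p)) (sym (Fin.toℕ-inject₁ j))))

  after-last : ∀ s {i} → suc (toℕ i) ≡ suc m → w′ ≡ after s i
  after-last s {i} p with view i
  ... | ‵fromℕ     = refl
  ... | ‵inject₁ j = contradiction
    (trans (sym (Fin.toℕ-inject₁ j)) (ℕ.suc-injective p)) (ℕ.<⇒≢ (Fin.toℕ<n j))

  after-step : ∀ s {i j} → toℕ j ≡ suc (toℕ i) → s j ≡ after s i
  after-step s {i} {j} p with view i
  ... | ‵fromℕ     = contradiction
    (trans p (cong suc (Fin.toℕ-fromℕ m))) (ℕ.<⇒≢ (Fin.toℕ<n j))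
  ... | ‵inject₁ k = cong s (Fin.toℕ-injective
    (trans p (cong suc (Fin.toℕ-inject₁ k))))

  RL-neighbours-complete : ∀ {x y : V} → RLAdjacent x y → y ∈ RL-neighbours x
  RL-neighbours-complete (fwd (uu p))  = there (here (after-step u p))
  RL-neighbours-complete (fwd (vv p))  = there (here (after-step v p))
  RL-neighbours-complete (fwd uv)      = there (there (here refl))
  RL-neighbours-complete (fwd (wu p))  = here (cong u (first p))
  RL-neighbours-complete (fwd (wv p))  = there (here (cong v (first p)))
  RL-neighbours-complete (fwd (w′u p)) = here (cong u (last p))
  RL-neighbours-complete (fwd (w′v p)) = there (here (cong v (last p)))
  RL-neighbours-complete (fwd ww′)     = there (there (here refl))
  RL-neighbours-complete (bwd (uu p))  = here (before-step u p)
  RL-neighbours-complete (bwd (vv p))  = here (before-step v p)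
  RL-neighbours-complete (bwd uv)      = there (there (here refl))
  RL-neighbours-complete (bwd (wu p))  = here (before-first u p)
  RL-neighbours-complete (bwd (wv p))  = here (before-first v p)
  RL-neighbours-complete (bwd (w′u p)) = there (here (after-last u p))
  RL-neighbours-complete (bwd (w′v p)) = there (here (after-last v p))
  RL-neighbours-complete (bwd ww′)     = there (there (here refl))

  before≢w′ : ∀ s → (∀ i → s i ≢ w′) → ∀ i → before s i ≢ w′
  before≢w′ s ≢w′ (suc i) eq = ≢w′ _ eq

  before-pred : ∀ s → (∀ {i j} → s i ≡ s j → i ≡ j) → (∀ i → s i ≢ w) →
                ∀ i {j} → before s i ≡ s j → toℕ i ≡ suc (toℕ j)
  before-pred s inj ≢w zero    eq = contradiction (sym eq) (≢w _)
  before-pred s inj ≢w (suc i) eq =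
    cong suc (trans (sym (Fin.toℕ-inject₁ i)) (cong toℕ (inj eq)))

  before≢after : ∀ s → (∀ {i j} → s i ≡ s j → i ≡ j) →
                 (∀ i → s i ≢ w) → (∀ i → s i ≢ w′) →
                 ∀ i → before s i ≢ after s i
  before≢after s inj ≢w ≢w′ i eq with view i
  ... | ‵fromℕ     = before≢w′ s ≢w′ (fromℕ m) eq
  ... | ‵inject₁ j = ℕ.<⇒≢ (ℕ.m≤n⇒m≤1+n (ℕ.n<1+n (toℕ j)))
    (trans (sym (Fin.toℕ-inject₁ j)) (before-pred s inj ≢w (inject₁ j) eq))

  before-u≢v : ∀ i {j} → before u i ≢ v j
  before-u≢v zero    ()
  before-u≢v (suc i) ()

  before-v≢u : ∀ i {j} → before v i ≢ u j
  before-v≢u zero    ()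
  before-v≢u (suc i) ()

  after-u≢v : ∀ i {j} → after u i ≢ v j
  after-u≢v i eq with view i
  after-u≢v i () | ‵fromℕ
  after-u≢v i () | ‵inject₁ _

  after-v≢u : ∀ i {j} → after v i ≢ u j
  after-v≢u i eq with view i
  after-v≢u i () | ‵fromℕ
  after-v≢u i () | ‵inject₁ _

  RL-neighbours-unique : ∀ (x : V) → Unique (RL-neighbours x)
  RL-neighbours-unique (u i) =
    (before≢after u u-injective (λ _ ()) (λ _ ()) i ∷ before-u≢v i ∷ []) ∷
    (after-u≢v i ∷ []) ∷ [] ∷ []
  RL-neighbours-unique (v i) =
    (before≢after v v-injective (λ _ ()) (λ _ ()) i ∷ before-v≢u i ∷ []) ∷
    (after-v≢u i ∷ []) ∷ [] ∷ []
  RL-neighbours-unique w     = ((λ ()) ∷ (λ ()) ∷ []) ∷ ((λ ()) ∷ []) ∷ [] ∷ []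
  RL-neighbours-unique w′    = ((λ ()) ∷ (λ ()) ∷ []) ∷ ((λ ()) ∷ []) ∷ [] ∷ []

RL : (n : ℕ) .{{_ : NonZero n}} → Graph
RL (suc m) = record
  { Vertex              = RLVertex (suc m)
  ; _≟_                 = _≟ᴿ_
  ; vertices            = us-vs-ws
  ; vertices-complete   = us-vs-ws-complete
  ; vertices-unique     = us-vs-ws-unique
  ; _~_                 = RLAdjacent
  ; ~-sym               = symmetric RLEdge
  ; ~-irrefl            = RL-irrefl
  ; connected           = RL-connected
  ; neighbours          = RL-neighbours
  ; neighbours-sound    = RL-neighbours-sound
  ; neighbours-complete = RL-neighbours-complete
  ; neighbours-unique   = RL-neighbours-unique
  }

peakRL : ℕ → ℕ
peakRL n =
  if n ≤ᵇ 6 then (n + 1) / 2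
  else if n ≡ᵇ 7 then 3
  else (n + 2) / 3 + 1

{-# OPTIONS --safe #-}

-- Replace the left end w of the ladder by a permutation π of the three strands
-- (the two rails and the edge w w′): a face arriving at the left end along the
-- strand x leaves it along π x.  Absorbing the first rung into the left end
-- gives again such a permutation and closes at most one face, so the faces can
-- be counted rung by rung, and only the kind of π (3-cycle, identity, exchange
-- of the rails, other transposition) matters.  The resulting linear recurrences
-- give g_i = 2 a_n(i) with a_n = c_n + (1 - x) Q_n, where, for n + 1 = 2 i + j,
--   2 Q_n(i) = 8^i T(i,j),   2 c_n(i+1) = 8^i 2^j T(i,j),
--   T(i,j) i! j! = (i + 2 j) (i + j - 1)!.
-- For n = 2 i + e with i ≥ 1, comparing g_i with g_(i+1) is then, up to
-- factorials, a polynomial inequality in i, e and P = 2^(e+3).  For n ≥ 8 it is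
-- a fall exactly if i ≥ e + 3, that is, if i ≥ [(n + 2) / 3] + 1; besides
-- polynomial identities this only takes P ≥ 9 e + 7, except at n = 10, i = 4,
-- where P itself is used.

module Submission where

open import Defs hiding (Dart)
open import Data.Bool.Base using (Bool; true; false; if_then_else_)
import Data.Bool.Base as Bool
open import Data.Fin.Base using (Fin; zero; suc; toℕ; _↑ˡ_; _↑ʳ_; splitAt; join; inject₁;
  fromℕ)
open import Data.Fin.Patterns using (0F; 1F; 2F; 3F; 4F; 5F; 6F; 7F; 8F)
import Data.Fin.Properties as Fin
open import Data.Fin.Relation.Unary.Top using (view; ‵fromℕ; ‵inject₁)
open import Data.List.Base as List using (List; []; _∷_; map; filter; deduplicate; length;
  iterate; allFin; concatMap; _++_; tabulate; cartesianProductWith)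
import Data.List.Membership.DecPropositional as DecMembership
open import Data.List.Membership.Propositional using (_∈_; lose)
open import Data.List.Membership.Propositional.Properties using (∈-map⁺; ∈-map⁻; ∈-lookup;
  ∈-allFin; ∈-deduplicate⁺; ∈-concatMap⁺)
open import Data.List.Membership.Propositional.Properties.WithK using (unique∧set⇒bag)
open import Data.List.Properties using (length-map; length-tabulate; map-concatMap;
  concatMap-cong; filter-++; length-++; ++-identityʳ)
open import Data.List.Relation.Binary.BagAndSetEquality using (∼bag⇒↭)
open import Data.List.Relation.Binary.Permutation.Propositional.Properties using (↭-length)
open import Data.List.Relation.Unary.All as All using (All; []; _∷_)
open import Data.List.Relation.Unary.AllPairs using ([]; _∷_)
open import Data.List.Relation.Unary.Any using (here; there; index)
open import Data.List.Relation.Unary.Any.Properties using (lookup-index)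
open import Data.List.Relation.Unary.Unique.DecPropositional.Properties using (deduplicate-!)
open import Data.List.Relation.Unary.Unique.Propositional using (Unique)
import Data.List.Relation.Unary.Unique.Propositional.Properties as Unique
open import Data.Maybe.Base as Maybe using (Maybe; just; nothing; fromMaybe)
import Data.Maybe.Properties as Maybe
open import Data.Nat.Base using (ℕ; zero; suc; _+_; _*_; _≤_; _<_; z≤n; s≤s; NonZero; _/_; _%_;
  _≡ᵇ_; _^_; _!; s≤s⁻¹)
open import Data.Nat.DivMod using (m≡m%n+[m/n]*n; m%n<n; m*n/n≡m; m/n*n≤m; /-monoˡ-≤)
open import Data.Nat.GeneralisedArithmetic using () renaming (iterate to iter)
import Data.Nat.Properties as ℕ
open import Data.Nat.Tactic.RingSolver using (solve-∀)
open import Data.Product.Base using (_×_; _,_; ∃; ∃₂; proj₁; proj₂)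
open import Data.Product.Properties using (≡-dec)
open import Data.Sum.Base using (_⊎_; inj₁; inj₂; [_,_]′)
import Data.Sum.Properties as Sum
open import Data.Vec.Base using (Vec; []; _∷_; lookup; zip)
open import Data.Vec.Properties using (lookup-zip)
open import Function.Base using (_∘_; id; const)
open import Function.Bundles using (_⇔_; mk⇔; Equivalence)
open import Function.Definitions using (Injective)
open import Relation.Binary.Construct.Closure.Equivalence using (EqClosure; symmetric)
open import Relation.Binary.Construct.Closure.ReflexiveTransitive using (ε; _◅_; _◅◅_)
open import Relation.Binary.Construct.Closure.Symmetric using (fwd; bwd)
open import Relation.Binary.Definitions using (DecidableEquality) renaming (Decidable to
  Decidable₂)
open import Relation.Binary.PropositionalEquality
open import Relation.Nullary using (Dec; yes; no; ¬?; contradiction)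
open import Relation.Nullary.Decidable using (map′; toWitness; _→-dec_; dec-true; dec-false;
  _×-dec_)
open import Relation.Unary using (Pred)

-- Orbits of a permutation of a finite set

-- All the topology is finite. The left end together with one rung has nine half-edges, so the way
-- faces cross this block is settled by evaluating the 6 permutations with the 4 choices of
-- rotations on a rung; only the gluing of the block to the rest of the ladder needs an argument.
-- Faces are therefore counted on half-edges that are built up rung by rung, and related to the
-- darts of the graph only at the end. The factor 1 - x is no accident: at x = 1 both a_n and c_n
-- count all 2 * 4^n choices, so their difference vanishes there. The comparison of coefficients is
-- tight along i = e + 2, where n = 3 e + 4. On this line the rise from i to i + 1 fails for n = 4
-- and n = 7 and holds from n = 10 on, which is why the formula for the peak settles so late. On the
-- neighbouring line i = e + 3 the fall dictates how large P has to be compared with e.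

SameOrbit : {A : Set} → (A → A) → A → A → Set
SameOrbit f = EqClosure (λ a b → f a ≡ b)

-- A map that is constant along f, separates orbits and is onto fixes k as the number of orbits. No
-- list of elements occurs, so such a record can be extended rung by rung before any darts are
-- enumerated.
record Orbits {A : Set} (f : A → A) (k : ℕ) : Set where
  field
    class          : A → Fin k
    rep            : Fin k → A
    class-rep      : ∀ c → class (rep c) ≡ c
    class-step     : ∀ a → class (f a) ≡ class a
    class-reflects : ∀ {a b} → class a ≡ class b → SameOrbit f a b

  class-orbit : ∀ {a b} → SameOrbit f a b → class a ≡ class b
  class-orbit ε                = refl
  class-orbit (fwd refl ◅ a~b) = trans (sym (class-step _)) (class-orbit a~b)
  class-orbit (bwd refl ◅ a~b) = trans (class-step _) (class-orbit a~b)

module _ {A : Set} {f : A → A} where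

  iter-+ : ∀ m n {a} → iter f a (m + n) ≡ iter f (iter f a m) n
  iter-+ zero    n = refl
  iter-+ (suc m) n = iter-+ m n

  iter-injective : Injective _≡_ _≡_ f → ∀ n {a b} → iter f a n ≡ iter f b n → a ≡ b
  iter-injective inj zero    eq = eq
  iter-injective inj (suc n) eq = inj (iter-injective inj n eq)

  iter-* : ∀ k n {a} → iter f a n ≡ a → iter f a (k * n) ≡ a
  iter-* zero    n     eq = refl
  iter-* (suc k) n {a} eq = begin
    iter f a (n + k * n)          ≡⟨ iter-+ n (k * n) ⟩
    iter f (iter f a n) (k * n)   ≡⟨ cong (λ b → iter f b (k * n)) eq ⟩
    iter f a (k * n)              ≡⟨ iter-* k n eq ⟩
    a                             ∎
    where open ≡-Reasoning

  iter-% : ∀ n p .{{_ : NonZero p}} {a} → iter f a p ≡ a → iter f a (n % p) ≡ iter f a n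
  iter-% n p {a} eq = begin
    iter f a (n % p)                         ≡⟨ cong (λ b → iter f b (n % p)) (iter-* (n / p) p eq) ⟨
    iter f (iter f a (n / p * p)) (n % p)    ≡⟨ iter-+ (n / p * p) (n % p) ⟨
    iter f a (n / p * p + n % p)             ≡⟨ cong (iter f a) (ℕ.+-comm (n / p * p) (n % p)) ⟩
    iter f a (n % p + n / p * p)             ≡⟨ cong (iter f a) (m≡m%n+[m/n]*n n p) ⟨
    iter f a n                               ∎
    where open ≡-Reasoning

  ∈-iterate : ∀ {k n} a → k < n → iter f a k ∈ iterate f a n
  ∈-iterate {zero}  a (s≤s _)   = here refl
  ∈-iterate {suc k} a (s≤s k<n) = there (∈-iterate (f a) k<n)

  iterate-orbit : ∀ {a b} n → b ∈ iterate f a n → SameOrbit f a b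
  iterate-orbit (suc n) (here refl) = ε
  iterate-orbit (suc n) (there b∈)  = fwd refl ◅ iterate-orbit n b∈

  map-iterate : ∀ {B : Set} (g : A → B) {h : B → B} → (∀ a → g (f a) ≡ h (g a)) →
                ∀ a n → map g (iterate f a n) ≡ iterate h (g a) n
  map-iterate g eq a zero        = refl
  map-iterate g {h} eq a (suc n) = cong (g a ∷_)
    (trans (map-iterate g eq (f a) n) (cong (λ b → iterate h b n) (eq a)))

  module _ (inj : Injective _≡_ _≡_ f) {xs : List A} (complete : ∀ a → a ∈ xs) where

    -- Pigeonhole on one more iterate than `xs` has entries; injectivity cancels the common part of
    -- the two equal iterates. The period is written `suc p`, which makes it a legal modulus.
    period : ∀ a → ∃ λ p → p < length xs × iter f a (suc p) ≡ a
    period a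
      with i , j , i<j , eq ←
        Fin.pigeonhole (ℕ.n<1+n (length xs)) (λ i → index (complete (iter f a (toℕ i))))
      with p , 1+i+p≡j ← ℕ.m≤n⇒∃[o]m+o≡n i<j
      = p , ℕ.≤-trans p<j (s≤s⁻¹ (Fin.toℕ<n j)) , iter-injective inj (toℕ i) (begin
        iter f (iter f a (suc p)) (toℕ i)  ≡⟨ iter-+ (suc p) (toℕ i) ⟨
        iter f a (suc p + toℕ i)           ≡⟨ cong (iter f a) j≡ ⟩
        iter f a (toℕ j)                   ≡⟨ lookup-index (complete (iter f a (toℕ j))) ⟩
        List.lookup xs _                        ≡⟨ cong (List.lookup xs) eq ⟨
        List.lookup xs _                        ≡⟨ lookup-index (complete (iter f a (toℕ i))) ⟨
        iter f a (toℕ i)                   ∎)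
      where
      open ≡-Reasoning
      j≡ : suc p + toℕ i ≡ toℕ j
      j≡ = trans (cong suc (ℕ.+-comm p (toℕ i))) 1+i+p≡j
      p<j : p < toℕ j
      p<j = subst (suc p ≤_) j≡ (ℕ.m≤m+n (suc p) (toℕ i))

    orbit-reach : ∀ {a b} → SameOrbit f a b → ∃ λ n → iter f a n ≡ b
    orbit-reach ε = 0 , refl
    orbit-reach (fwd refl ◅ a~b) with n , eq ← orbit-reach a~b = suc n , eq
    -- One step backwards is `p` steps forwards, since `suc p` steps return to `c`.
    orbit-reach (_◅_ {j = c} (bwd refl) a~b)
      with n , eq ← orbit-reach a~b | p , _ , per ← period c =
      p + n , trans (iter-+ p n) (trans (cong (λ b → iter f b n) per) eq)

    -- `faceOf` lists as many iterates as there are darts. Reducing the exponent modulo the period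
    -- shows that this reaches the whole orbit.
    orbit-iterate : ∀ {a b} → SameOrbit f a b → b ∈ iterate f a (length xs)
    orbit-iterate {a} a~b with n , refl ← orbit-reach a~b | p , p< , per ← period a =
      subst (_∈ _) (iter-% n (suc p) per) (∈-iterate a (ℕ.<-≤-trans (m%n<n n (suc p)) p<))

-- Deduplicated lists and the number of orbits

module _ {A B : Set} {ℓ₁ ℓ₂} {P : Pred A ℓ₁} {Q : Pred B ℓ₂}
         (P? : ∀ x → Dec (P x)) (Q? : ∀ y → Dec (Q y)) where

  map-filter-⇔ : (h : A → B) → (∀ x → P x ⇔ Q (h x)) →
                 ∀ xs → map h (filter P? xs) ≡ filter Q? (map h xs)
  map-filter-⇔ h P⇔Q []       = refl
  map-filter-⇔ h P⇔Q (x ∷ xs) with P? x | Q? (h x)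
  ... | yes _ | yes _ = cong (h x ∷_) (map-filter-⇔ h P⇔Q xs)
  ... | no _  | no _  = map-filter-⇔ h P⇔Q xs
  ... | yes p | no ¬q = contradiction (Equivalence.to (P⇔Q x) p) ¬q
  ... | no ¬p | yes q = contradiction (Equivalence.from (P⇔Q x) q) ¬p

map-deduplicate-⇔ : {A B : Set} {R : A → A → Set} {S : B → B → Set}
  (R? : Decidable₂ R) (S? : Decidable₂ S) (h : A → B) → (∀ x y → R x y ⇔ S (h x) (h y)) →
  ∀ xs → map h (deduplicate R? xs) ≡ deduplicate S? (map h xs)
map-deduplicate-⇔ R? S? h R⇔S []       = refl
map-deduplicate-⇔ R? S? h R⇔S (x ∷ xs) = cong (h x ∷_) (trans
  (map-filter-⇔ (¬? ∘ R? x) (¬? ∘ S? (h x)) h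
    (λ y → mk⇔ (_∘ Equivalence.from (R⇔S x y)) (_∘ Equivalence.to (R⇔S x y))) (deduplicate R? xs))
  (cong (filter (¬? ∘ S? (h x))) (map-deduplicate-⇔ R? S? h R⇔S xs)))

length-deduplicate-Fin : ∀ {k} (cs : List (Fin k)) → (∀ c → c ∈ cs) →
                         length (deduplicate Fin._≟_ cs) ≡ k
length-deduplicate-Fin {k} cs complete = trans
  (↭-length (∼bag⇒↭ (unique∧set⇒bag (deduplicate-! Fin._≟_ cs) (Unique.allFin⁺ k)
    (mk⇔ (λ _ → ∈-allFin _) (λ _ → ∈-deduplicate⁺ Fin._≟_ (complete _))))))
  (length-tabulate id)

-- Passing to classes turns deduplication by orbit into deduplication by equality of a list that
-- meets all of `Fin k`. The map `g` carries half-edges to darts, and `R?` is left arbitrary so that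
-- the very test used in `faces` can be inserted.
length-deduplicate-orbits :
  ∀ {A B : Set} {f : A → A} {h : B → B} {k} → Orbits f k → Injective _≡_ _≡_ f →
  ∀ {xs} → (∀ a → a ∈ xs) →
  (g : A → B) → Injective _≡_ _≡_ g → (∀ a → g (f a) ≡ h (g a)) →
  ∀ {ys} → map g xs ≡ ys → (R? : Decidable₂ (λ d e → e ∈ iterate h d (length ys))) →
  length (deduplicate R? ys) ≡ k
length-deduplicate-orbits {f = f} {h} {k} O f-inj {xs} complete g g-inj g-f refl R? = begin
  length (deduplicate R? (map g xs))
    ≡⟨ cong length (map-deduplicate-⇔ R′? R? g (λ _ _ → mk⇔ id id) xs) ⟨
  length (map g (deduplicate R′? xs))                   ≡⟨ length-map g (deduplicate R′? xs) ⟩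
  length (deduplicate R′? xs)                           ≡⟨ length-map class (deduplicate R′? xs) ⟨
  length (map class (deduplicate R′? xs))
    ≡⟨ cong length (map-deduplicate-⇔ R′? Fin._≟_ class same xs) ⟩
  length (deduplicate Fin._≟_ (map class xs))           ≡⟨ length-deduplicate-Fin (map class xs) classes ⟩
  k                                                     ∎
  where
  open ≡-Reasoning
  open Orbits O
  R′? : Decidable₂ (λ a b → g b ∈ iterate h (g a) (length (map g xs)))
  R′? a b = R? (g a) (g b)
  images : ∀ a → map g (iterate f a (length xs)) ≡ iterate h (g a) (length (map g xs))
  images a = trans (map-iterate g g-f a _) (cong (iterate h (g a)) (sym (length-map g xs)))
  to : ∀ a b → g b ∈ iterate h (g a) (length (map g xs)) → class a ≡ class b
  to a b gb∈ with c , c∈ , gb≡gc ← ∈-map⁻ g (subst (g b ∈_) (sym (images a)) gb∈)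
    with refl ← g-inj gb≡gc = class-orbit (iterate-orbit (length xs) c∈)
  same : ∀ a b → (g b ∈ iterate h (g a) (length (map g xs))) ⇔ (class a ≡ class b)
  same a b = mk⇔ (to a b) (λ eq → subst (g b ∈_) (images a)
    (∈-map⁺ g (orbit-iterate f-inj complete (class-reflects eq))))
  classes : ∀ c → c ∈ map class xs
  classes c = subst (_∈ map class xs) (class-rep c) (∈-map⁺ class (complete (rep c)))

Unique-map⇒injective : {A B : Set} {f : A → B} {xs : List A} → Unique (map f xs) →
                       ∀ {x y} → x ∈ xs → y ∈ xs → f x ≡ f y → x ≡ y
Unique-map⇒injective (_ ∷ uniq) (here refl) (here refl) eq = refl
Unique-map⇒injective (fx∉ ∷ _)  (here refl) (there y∈)  eq =
  contradiction eq (All.lookup fx∉ (∈-map⁺ _ y∈))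
Unique-map⇒injective (fy∉ ∷ _)  (there x∈)  (here refl) eq =
  contradiction (sym eq) (All.lookup fy∉ (∈-map⁺ _ x∈))
Unique-map⇒injective (_ ∷ uniq) (there x∈)  (there y∈)  eq = Unique-map⇒injective uniq x∈ y∈ eq

-- Half-edges of the ladder

data Side : Set where
  uˢ vˢ : Side

-- The three edges met by a cut across the graph: the two rails and w w′.
data Strand : Set where
  rail : Side → Strand
  link : Strand

data Dir : Set where
  back forth rung : Dir

other : Side → Side
other uˢ = vˢ
other vˢ = uˢ

pick : {A : Set} → Side → A × A → A
pick uˢ = proj₁
pick vˢ = proj₂

turn : Bool → Dir → Dir
turn false back  = forth
turn false forth = rung
turn false rung  = back
turn true  back  = rung
turn true  rung  = forth
turn true  forth = back

data Perm : Set where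
  ι swap-uv swap-ul swap-vl cycle cycle⁻¹ : Perm

⟦_⟧ : Perm → Strand → Strand
⟦ ι ⟧       x         = x
⟦ swap-uv ⟧ (rail s)  = rail (other s)
⟦ swap-uv ⟧ link      = link
⟦ swap-ul ⟧ (rail uˢ) = link
⟦ swap-ul ⟧ (rail vˢ) = rail vˢ
⟦ swap-ul ⟧ link      = rail uˢ
⟦ swap-vl ⟧ (rail uˢ) = rail uˢ
⟦ swap-vl ⟧ (rail vˢ) = link
⟦ swap-vl ⟧ link      = rail vˢ
⟦ cycle ⟧   (rail uˢ) = rail vˢ
⟦ cycle ⟧   (rail vˢ) = link
⟦ cycle ⟧   link      = rail uˢ
⟦ cycle⁻¹ ⟧ (rail uˢ) = link
⟦ cycle⁻¹ ⟧ (rail vˢ) = rail uˢ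
⟦ cycle⁻¹ ⟧ link      = rail vˢ

-- The permutation with given values at the two rails; the two values are
-- assumed to be different.
fromValues : Strand → Strand → Perm
fromValues (rail uˢ) (rail _)  = ι
fromValues (rail uˢ) link      = swap-vl
fromValues (rail vˢ) (rail _)  = swap-uv
fromValues (rail vˢ) link      = cycle
fromValues link      (rail uˢ) = cycle⁻¹
fromValues link      _         = swap-ul

-- Half-edges, named by the vertex they leave.  The left end and the right end
-- each have one half-edge per strand.
data HalfEdge (m : ℕ) : Set where
  left right : Strand → HalfEdge m
  at         : Side → Fin m → Dir → HalfEdge m

-- The shorter ladder is viewed as the longer one whose left end has swallowed the first rung: its
-- left rails are the half-edges leaving that rung forwards, while its link still starts at the old
-- end.
far : ∀ {m} → HalfEdge m → HalfEdge (suc m)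
far (left (rail s)) = at s zero forth
far (left link)     = left link
far (right x)       = right x
far (at s i d)      = at s (suc i) d

-- The recursion through `far` is chosen so that `rev-far` holds case by case by computation;
-- absorbing a rung rests on that equation.
rev : ∀ {m} → HalfEdge m → HalfEdge m
rev {zero}  (left x)          = right x
rev {zero}  (right x)         = left x
rev {suc m} (left (rail s))   = at s zero back
rev {suc m} (left link)       = far (rev (left link))
rev {suc m} (right x)         = far (rev (right x))
rev {suc m} (at s zero back)  = left (rail s)
rev {suc m} (at s zero forth) = far (rev (left (rail s)))
rev {suc m} (at s zero rung)  = at (other s) zero rung
rev {suc m} (at s (suc i) d)  = far (rev (at s i d))

Rungs : ℕ → Set
Rungs = Vec (Bool × Bool)

rot : ∀ {m} → Perm → Rungs m → Perm → HalfEdge m → HalfEdge m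
rot π bs τ (left x)   = left (⟦ π ⟧ x)
rot π bs τ (right x)  = right (⟦ τ ⟧ x)
rot π bs τ (at s i d) = at s i (turn (pick s (lookup bs i)) d)

next : ∀ {m} → Perm → Rungs m → Perm → HalfEdge m → HalfEdge m
next π bs τ = rot π bs τ ∘ rev

rev-far : ∀ {m} (d : HalfEdge m) → rev (far d) ≡ far (rev d)
rev-far (left (rail s)) = refl
rev-far (left link)     = refl
rev-far (right x)       = refl
rev-far (at s i d)      = refl

other-involutive : ∀ s → other (other s) ≡ s
other-involutive uˢ = refl
other-involutive vˢ = refl

rev-involutive : ∀ {m} (d : HalfEdge m) → rev (rev d) ≡ d
far-rev-involutive : ∀ {m} (d : HalfEdge m) → rev (far (rev d)) ≡ far d

rev-involutive {zero}  (left x)          = refl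
rev-involutive {zero}  (right x)         = refl
rev-involutive {suc m} (left (rail s))   = refl
rev-involutive {suc m} (left link)       = far-rev-involutive (left link)
rev-involutive {suc m} (right x)         = far-rev-involutive (right x)
rev-involutive {suc m} (at s zero back)  = refl
rev-involutive {suc m} (at s zero forth) = far-rev-involutive (left (rail s))
rev-involutive {suc m} (at s zero rung)  = cong (λ s → at s zero rung) (other-involutive s)
rev-involutive {suc m} (at s (suc i) d)  = far-rev-involutive (at s i d)

far-rev-involutive d = trans (rev-far (rev d)) (cong far (rev-involutive d))

-- Absorbing a rung into the left end

-- The left end together with the first rung.
data Block : Set where
  left₁ : Strand → Block
  at₁   : Side → Dir → Block

embed : ∀ {m} → Block → HalfEdge (suc m)
embed (left₁ x) = left x
embed (at₁ s d) = at s zero d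

exit : Strand → Block
exit (rail s) = at₁ s forth
exit link     = left₁ link

exit? : Block → Maybe Strand
exit? (left₁ link)    = just link
exit? (at₁ s forth)   = just (rail s)
exit? (left₁ (rail s)) = nothing
exit? (at₁ s back)    = nothing
exit? (at₁ s rung)    = nothing

rev₁ : Block → Block
rev₁ (left₁ (rail s)) = at₁ s back
rev₁ (at₁ s back)     = left₁ (rail s)
rev₁ (at₁ s rung)     = at₁ (other s) rung
-- The reverse of an exit lies beyond the block, where `chase` has already stopped.
rev₁ b                = b

module _ (π : Perm) (r : Bool × Bool) where

  rot₁ next₁ : Block → Block
  rot₁ (left₁ x) = left₁ (⟦ π ⟧ x)
  rot₁ (at₁ s d) = at₁ s (turn (pick s r) d)
  next₁ = rot₁ ∘ rev₁

  chase : ℕ → Block → Block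
  chase zero    b = b
  chase (suc n) b with exit? b
  ... | just _  = b
  ... | nothing = chase n (next₁ b)

  -- Three of the nine half-edges of the block are exits. A chase that repeats one of the other six
  -- never leaves, so six steps decide.
  outcome : Block → Maybe Strand
  outcome b = exit? (chase 6 b)

  -- A face reaching the block along `x` arrives on the reverse of `exit x`, so it goes on with the
  -- rotation applied to `exit x`.
  firstReturn : Strand → Strand
  firstReturn x = fromMaybe x (outcome (rot₁ (exit x)))

  -- The permutation of the strands induced by the left end and the first rung
  -- together.
  absorb : Perm
  absorb = fromValues (firstReturn (rail uˢ)) (firstReturn (rail vˢ))

  firstTrapped : List Block → Maybe Block
  firstTrapped []       = nothing
  firstTrapped (b ∷ bs) with outcome b
  ... | just _  = firstTrapped bs
  ... | nothing = just b

  -- At most one face is contained in the block.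
  trapped : Maybe Block
  trapped = firstTrapped
    (left₁ (rail uˢ) ∷ left₁ (rail vˢ) ∷ at₁ uˢ back ∷ at₁ uˢ rung ∷ at₁ vˢ back ∷ at₁ vˢ rung ∷ [])

  closed : ℕ
  closed with trapped
  ... | nothing = 0
  ... | just _  = 1

  trappedRep : Fin closed → Block
  trappedRep j with just b ← trapped = b

  -- The fate of the face through a half-edge: trapped in the block, or leaving along a strand. It
  -- is constant until the exit, and the orbit classes of the longer ladder are read off from it.
  target : Block → Fin closed ⊎ Strand
  target b with outcome b | trapped
  ... | just x  | _       = inj₂ x
  ... | nothing | just _  = inj₁ zero
  ... | nothing | nothing = inj₂ link

  canonical : Fin closed ⊎ Strand → Block
  canonical = [ trappedRep , exit ]′

-- Statements about a single block, decided by evaluation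

∀? : {A : Set} {P : A → Set} (xs : List A) → (∀ a → a ∈ xs) →
     (∀ a → Dec (P a)) → Dec (∀ a → P a)
∀? xs complete P? = map′ (λ all a → All.lookup all (complete a)) (λ p → All.universal p xs)
  (All.all? P? xs)

∀Strand? : {P : Strand → Set} → (∀ x → Dec (P x)) → Dec (∀ x → P x)
∀Strand? = ∀? (rail uˢ ∷ rail vˢ ∷ link ∷ []) λ where
  (rail uˢ) → here refl
  (rail vˢ) → there (here refl)
  link      → there (there (here refl))

∀Perm? : {P : Perm → Set} → (∀ π → Dec (P π)) → Dec (∀ π → P π)
∀Perm? = ∀? (ι ∷ swap-uv ∷ swap-ul ∷ swap-vl ∷ cycle ∷ cycle⁻¹ ∷ []) λ where
  ι       → here refl
  swap-uv → there (here refl)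
  swap-ul → there (there (here refl))
  swap-vl → there (there (there (here refl)))
  cycle   → there (there (there (there (here refl))))
  cycle⁻¹ → there (there (there (there (there (here refl)))))

∀Rung? : {P : Bool × Bool → Set} → (∀ r → Dec (P r)) → Dec (∀ r → P r)
∀Rung? = ∀? ((false , false) ∷ (false , true) ∷ (true , false) ∷ (true , true) ∷ []) λ where
  (false , false) → here refl
  (false , true)  → there (here refl)
  (true , false)  → there (there (here refl))
  (true , true)   → there (there (there (here refl)))

blocks : List Block
blocks = left₁ (rail uˢ) ∷ left₁ (rail vˢ) ∷ left₁ link ∷
  at₁ uˢ back ∷ at₁ uˢ forth ∷ at₁ uˢ rung ∷ at₁ vˢ back ∷ at₁ vˢ forth ∷ at₁ vˢ rung ∷ []

blockIndex : Block → Fin 9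
blockIndex (left₁ (rail uˢ)) = 0F
blockIndex (left₁ (rail vˢ)) = 1F
blockIndex (left₁ link)      = 2F
blockIndex (at₁ uˢ back)     = 3F
blockIndex (at₁ uˢ forth)    = 4F
blockIndex (at₁ uˢ rung)     = 5F
blockIndex (at₁ vˢ back)     = 6F
blockIndex (at₁ vˢ forth)    = 7F
blockIndex (at₁ vˢ rung)     = 8F

lookup-blockIndex : ∀ b → List.lookup blocks (blockIndex b) ≡ b
lookup-blockIndex (left₁ (rail uˢ)) = refl
lookup-blockIndex (left₁ (rail vˢ)) = refl
lookup-blockIndex (left₁ link)      = refl
lookup-blockIndex (at₁ uˢ back)     = refl
lookup-blockIndex (at₁ uˢ forth)    = refl
lookup-blockIndex (at₁ uˢ rung)     = refl
lookup-blockIndex (at₁ vˢ back)     = refl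
lookup-blockIndex (at₁ vˢ forth)    = refl
lookup-blockIndex (at₁ vˢ rung)     = refl

∀Block? : {P : Block → Set} → (∀ b → Dec (P b)) → Dec (∀ b → P b)
∀Block? = ∀? blocks λ b → subst (_∈ blocks) (lookup-blockIndex b) (∈-lookup (blockIndex b))

_≟ᴮ_ : DecidableEquality Block
b ≟ᴮ c = map′ (λ eq → trans (sym (lookup-blockIndex b))
  (trans (cong (List.lookup blocks) eq) (lookup-blockIndex c))) (cong blockIndex)
  (blockIndex b Fin.≟ blockIndex c)

exit-injective : ∀ {x y} → exit x ≡ exit y → x ≡ y
exit-injective {rail _} {rail _} refl = refl
exit-injective {link}   {link}   refl = refl

_≟ˢ_ : DecidableEquality Strand
x ≟ˢ y = map′ exit-injective (cong exit) (exit x ≟ᴮ exit y)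

Endpoint? : ∀ {k} → DecidableEquality (Fin k ⊎ Strand)
Endpoint? = Sum.≡-dec Fin._≟_ _≟ˢ_

abstract
  target-next₁ : ∀ π r b → exit? b ≡ nothing → target π r (next₁ π r b) ≡ target π r b
  target-next₁ = toWitness {a? = ∀Perm? λ π → ∀Rung? λ r → ∀Block? λ b →
    Maybe.≡-dec _≟ˢ_ (exit? b) nothing →-dec Endpoint? (target π r (next₁ π r b)) (target π r b)} _

  target-exit : ∀ π r x → target π r (exit x) ≡ inj₂ x
  target-exit = toWitness {a? = ∀Perm? λ π → ∀Rung? λ r → ∀Strand? λ x →
    Endpoint? (target π r (exit x)) (inj₂ x)} _

  target-return : ∀ π r x → target π r (rot₁ π r (exit x)) ≡ inj₂ (⟦ absorb π r ⟧ x)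
  target-return = toWitness {a? = ∀Perm? λ π → ∀Rung? λ r → ∀Strand? λ x →
    Endpoint? (target π r (rot₁ π r (exit x))) (inj₂ (⟦ absorb π r ⟧ x))} _

  target-trapped : ∀ π r j → target π r (trappedRep π r j) ≡ inj₁ j
  target-trapped = toWitness {a? = ∀Perm? λ π → ∀Rung? λ r → Fin.all? λ j →
    Endpoint? (target π r (trappedRep π r j)) (inj₁ j)} _

  -- The bounded number of steps makes reachability decidable; `chase-orbit` turns it into an orbit
  -- relation in the ladder.
  chase-canonical : ∀ π r b → ∃ λ (n : Fin 7) →
                    chase π r (toℕ n) b ≡ canonical π r (target π r b)
  chase-canonical = toWitness {a? = ∀Perm? λ π → ∀Rung? λ r → ∀Block? λ b → Fin.any? λ n →
    chase π r (toℕ n) b ≟ᴮ canonical π r (target π r b)} _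

-- Orbits before and after absorbing a rung

module _ {m} (π : Perm) (r : Bool × Bool) (bs : Rungs m) (τ : Perm) where

  private
    f  = next π (r ∷ bs) τ
    f′ = next (absorb π r) bs τ

  rot-embed : ∀ b → rot π (r ∷ bs) τ (embed b) ≡ embed (rot₁ π r b)
  rot-embed (left₁ x) = refl
  rot-embed (at₁ s d) = refl

  next-embed : ∀ b → exit? b ≡ nothing → f (embed b) ≡ embed (next₁ π r b)
  next-embed b@(left₁ (rail s)) _ = rot-embed (rev₁ b)
  next-embed b@(at₁ s back)     _ = rot-embed (rev₁ b)
  next-embed b@(at₁ s rung)     _ = rot-embed (rev₁ b)

  chase-orbit : ∀ n b → SameOrbit f (embed b) (embed (chase π r n b))
  chase-orbit zero    b = ε
  chase-orbit (suc n) b with exit? b in eq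
  ... | just _  = ε
  ... | nothing = fwd (next-embed b eq) ◅ chase-orbit n (next₁ π r b)

  embed-orbit : ∀ b → SameOrbit f (embed b) (embed (canonical π r (target π r b)))
  embed-orbit b with n , eq ← chase-canonical π r b =
    subst (SameOrbit f (embed b)) (cong embed eq) (chase-orbit (toℕ n) b)

  embed-exit : ∀ x → embed {m} (exit x) ≡ far (left x)
  embed-exit (rail s) = refl
  embed-exit link     = refl

  return-orbit : ∀ x → SameOrbit f (embed (rot₁ π r (exit x))) (far (left (⟦ absorb π r ⟧ x)))
  return-orbit x = subst (SameOrbit f _)
    (trans (cong (embed ∘ canonical π r) (target-return π r x)) (embed-exit _))
    (embed-orbit (rot₁ π r (exit x)))

  -- One step of the shorter ladder is an excursion of the longer one: a face coming to the left end
  -- along a strand runs through the block up to its first return.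
  far-next : ∀ d → SameOrbit f (far d) (far (f′ d))
  far-next d = fwd (cong (rot π (r ∷ bs) τ) (rev-far d)) ◅ rotate (rev d)
    where
    rotate : ∀ e → SameOrbit f (rot π (r ∷ bs) τ (far e)) (far (rot (absorb π r) bs τ e))
    rotate (left (rail s)) = return-orbit (rail s)
    rotate (left link)     = return-orbit link
    rotate (right x)       = ε
    rotate (at s i d)      = ε

  far-orbit : ∀ {d e} → SameOrbit f′ d e → SameOrbit f (far d) (far e)
  far-orbit ε                = ε
  far-orbit (fwd refl ◅ d~e) = far-next _ ◅◅ far-orbit d~e
  far-orbit (bwd refl ◅ d~e) = symmetric _ (far-next _) ◅◅ far-orbit d~e

  module _ {k} (O : Orbits f′ k) where

    private
      module O = Orbits O
      c = closed π r

    endpointClass : Fin c ⊎ Strand → Fin (c + k)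
    endpointClass (inj₁ j) = j ↑ˡ k
    endpointClass (inj₂ x) = c ↑ʳ O.class (left x)

    classOf : HalfEdge (suc m) → Fin (c + k)
    classOf (left x)        = endpointClass (target π r (left₁ x))
    classOf (right x)       = c ↑ʳ O.class (right x)
    classOf (at s zero d)   = endpointClass (target π r (at₁ s d))
    classOf (at s (suc i) d) = c ↑ʳ O.class (at s i d)

    classOf-embed : ∀ b → classOf (embed b) ≡ endpointClass (target π r b)
    classOf-embed (left₁ x) = refl
    classOf-embed (at₁ s d) = refl

    classOf-far : ∀ d → classOf (far d) ≡ c ↑ʳ O.class d
    classOf-far (left (rail s)) = cong endpointClass (target-exit π r (rail s))
    classOf-far (left link)     = cong endpointClass (target-exit π r link)
    classOf-far (right x)       = refl
    classOf-far (at s i d)      = refl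

    classOf-rot-far : ∀ e → classOf (rot π (r ∷ bs) τ (far e)) ≡ c ↑ʳ O.class (rot (absorb π r) bs τ e)
    classOf-rot-far (left (rail s)) = cong endpointClass (target-return π r (rail s))
    classOf-rot-far (left link)     = cong endpointClass (target-return π r link)
    classOf-rot-far (right x)       = refl
    classOf-rot-far (at s i d)      = refl

    classOf-next-far : ∀ d → classOf (f (far d)) ≡ classOf (far d)
    classOf-next-far d = begin
      classOf (rot π (r ∷ bs) τ (rev (far d)))   ≡⟨ cong (classOf ∘ rot π (r ∷ bs) τ) (rev-far d) ⟩
      classOf (rot π (r ∷ bs) τ (far (rev d)))   ≡⟨ classOf-rot-far (rev d) ⟩
      c ↑ʳ O.class (f′ d)                        ≡⟨ cong (c ↑ʳ_) (O.class-step d) ⟩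
      c ↑ʳ O.class d                             ≡⟨ classOf-far d ⟨
      classOf (far d)                            ∎
      where open ≡-Reasoning

    classOf-next-embed : ∀ b → exit? b ≡ nothing → classOf (f (embed b)) ≡ classOf (embed b)
    classOf-next-embed b inner = begin
      classOf (f (embed b))                      ≡⟨ cong classOf (next-embed b inner) ⟩
      classOf (embed (next₁ π r b))              ≡⟨ classOf-embed (next₁ π r b) ⟩
      endpointClass (target π r (next₁ π r b))   ≡⟨ cong endpointClass (target-next₁ π r b inner) ⟩
      endpointClass (target π r b)               ≡⟨ classOf-embed b ⟨
      classOf (embed b)                          ∎
      where open ≡-Reasoning

    classOf-next : ∀ d → classOf (f d) ≡ classOf d
    classOf-next (left (rail s))   = classOf-next-embed (left₁ (rail s)) refl
    classOf-next (left link)       = classOf-next-far (left link)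
    classOf-next (right x)         = classOf-next-far (right x)
    classOf-next (at s zero back)  = classOf-next-embed (at₁ s back) refl
    classOf-next (at s zero forth) = classOf-next-far (left (rail s))
    classOf-next (at s zero rung)  = classOf-next-embed (at₁ s rung) refl
    classOf-next (at s (suc i) d)  = classOf-next-far (at s i d)

    repOf : Fin c ⊎ Fin k → HalfEdge (suc m)
    repOf (inj₁ j) = embed (trappedRep π r j)
    repOf (inj₂ q) = far (O.rep q)

    classOf-repOf : ∀ q → classOf (repOf q) ≡ join c k q
    classOf-repOf (inj₁ j) = trans (classOf-embed (trappedRep π r j)) (cong endpointClass (target-trapped π r j))
    classOf-repOf (inj₂ q) = trans (classOf-far (O.rep q)) (cong (c ↑ʳ_) (O.class-rep q))

    toRep : ∀ d → SameOrbit f d (repOf (splitAt c (classOf d)))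
    toRep-far : ∀ d → SameOrbit f (far d) (repOf (splitAt c (c ↑ʳ O.class d)))
    toRep-endpoint : ∀ q → SameOrbit f (embed (canonical π r q)) (repOf (splitAt c (endpointClass q)))
    toRep-embed : ∀ b → SameOrbit f (embed b) (repOf (splitAt c (endpointClass (target π r b))))

    toRep (left x)         = toRep-embed (left₁ x)
    toRep (right x)        = toRep-far (right x)
    toRep (at s zero d)    = toRep-embed (at₁ s d)
    toRep (at s (suc i) d) = toRep-far (at s i d)

    toRep-far d rewrite Fin.splitAt-↑ʳ c k (O.class d) =
      far-orbit (O.class-reflects (sym (O.class-rep (O.class d))))

    toRep-endpoint (inj₁ j) rewrite Fin.splitAt-↑ˡ c j k = ε
    toRep-endpoint (inj₂ x) rewrite embed-exit x = toRep-far (left x)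

    toRep-embed b = embed-orbit b ◅◅ toRep-endpoint (target π r b)

    -- Every half-edge inside the block is trapped or runs into an exit, hence into the image of
    -- `far`. So the orbits are the trapped one, if present, and those of the shorter ladder, kept
    -- apart by the invariant `classOf`.
    absorb-orbits : Orbits f (c + k)
    absorb-orbits = record
      { class          = classOf
      ; rep            = repOf ∘ splitAt c
      ; class-rep      = λ q → trans (classOf-repOf (splitAt c q)) (Fin.join-splitAt c k q)
      ; class-step     = classOf-next
      ; class-reflects = λ {d} {e} eq → toRep d ◅◅
          subst (λ q → SameOrbit f (repOf (splitAt c q)) e) (sym eq) (symmetric _ (toRep e))
      }

turn-injective : ∀ t {d e} → turn t d ≡ turn t e → d ≡ e
turn-injective false {back}  {back}  _ = refl
turn-injective false {forth} {forth} _ = refl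
turn-injective false {rung}  {rung}  _ = refl
turn-injective true  {back}  {back}  _ = refl
turn-injective true  {forth} {forth} _ = refl
turn-injective true  {rung}  {rung}  _ = refl

abstract
  perm-injective : ∀ π x y → ⟦ π ⟧ x ≡ ⟦ π ⟧ y → x ≡ y
  perm-injective = toWitness {a? = ∀Perm? λ π → ∀Strand? λ x → ∀Strand? λ y →
    (⟦ π ⟧ x ≟ˢ ⟦ π ⟧ y) →-dec (x ≟ˢ y)} _

module _ {m : ℕ} where

  left-injective : ∀ {x y} → left {m} x ≡ left y → x ≡ y
  left-injective refl = refl

  right-injective : ∀ {x y} → right {m} x ≡ right y → x ≡ y
  right-injective refl = refl

  at-injective : ∀ {s t i j d e} → at {m} s i d ≡ at t j e → s ≡ t × i ≡ j × d ≡ e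
  at-injective refl = refl , refl , refl

module _ {m} (π : Perm) (bs : Rungs m) (τ : Perm) where

  rot-injective : ∀ {d e} → rot π bs τ d ≡ rot π bs τ e → d ≡ e
  rot-injective {left x}   {left y}   eq = cong left (perm-injective π x y (left-injective eq))
  rot-injective {right x}  {right y}  eq = cong right (perm-injective τ x y (right-injective eq))
  rot-injective {at s i d} {at t j e} eq with refl , refl , eq′ ← at-injective eq =
    cong (at s i) (turn-injective _ eq′)

  next-injective : Injective _≡_ _≡_ (next π bs τ)
  next-injective {d} {e} eq = begin
    d            ≡⟨ rev-involutive d ⟨
    rev (rev d)  ≡⟨ cong rev (rot-injective eq) ⟩
    rev (rev e)  ≡⟨ rev-involutive e ⟩
    e            ∎
    where open ≡-Reasoning

-- The ladder without rungs

infixl 7 _·_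
_·_ : Perm → Perm → Perm
π · τ = fromValues (⟦ π ⟧ (⟦ τ ⟧ (rail uˢ))) (⟦ π ⟧ (⟦ τ ⟧ (rail vˢ)))

cycles : Perm → ℕ
cycles ι        = 3
cycles swap-uv  = 2
cycles swap-ul  = 2
cycles swap-vl  = 2
cycles cycle    = 1
cycles cycle⁻¹  = 1

cycleOf : ∀ σ → Strand → Fin (cycles σ)
cycleOf ι       (rail uˢ) = 0F
cycleOf ι       (rail vˢ) = 1F
cycleOf ι       link      = 2F
cycleOf swap-uv (rail _)  = 0F
cycleOf swap-uv link      = 1F
cycleOf swap-ul (rail vˢ) = 1F
cycleOf swap-ul _         = 0F
cycleOf swap-vl (rail uˢ) = 1F
cycleOf swap-vl _         = 0F
cycleOf cycle   _         = 0F
cycleOf cycle⁻¹ _         = 0F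

cycleRep : ∀ σ → Fin (cycles σ) → Strand
cycleRep ι       0F = rail uˢ
cycleRep ι       1F = rail vˢ
cycleRep ι       2F = link
cycleRep swap-uv 0F = rail uˢ
cycleRep swap-uv 1F = link
cycleRep swap-ul 0F = link
cycleRep swap-ul 1F = rail vˢ
cycleRep swap-vl 0F = link
cycleRep swap-vl 1F = rail uˢ
cycleRep cycle   0F = link
cycleRep cycle⁻¹ 0F = link

abstract
  ⟦·⟧ : ∀ π τ x → ⟦ π · τ ⟧ x ≡ ⟦ π ⟧ (⟦ τ ⟧ x)
  ⟦·⟧ = toWitness {a? = ∀Perm? λ π → ∀Perm? λ τ → ∀Strand? λ x →
    ⟦ π · τ ⟧ x ≟ˢ ⟦ π ⟧ (⟦ τ ⟧ x)} _

  cycleOf-step : ∀ σ x → cycleOf σ (⟦ σ ⟧ x) ≡ cycleOf σ x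
  cycleOf-step = toWitness {a? = ∀Perm? λ σ → ∀Strand? λ x →
    cycleOf σ (⟦ σ ⟧ x) Fin.≟ cycleOf σ x} _

  cycleOf-rep : ∀ σ c → cycleOf σ (cycleRep σ c) ≡ c
  cycleOf-rep = toWitness {a? = ∀Perm? λ σ → Fin.all? λ c →
    cycleOf σ (cycleRep σ c) Fin.≟ c} _

  cycleRep-reach : ∀ σ x → ∃ λ (n : Fin 3) → iter ⟦ σ ⟧ x (toℕ n) ≡ cycleRep σ (cycleOf σ x)
  cycleRep-reach = toWitness {a? = ∀Perm? λ σ → ∀Strand? λ x → Fin.any? λ n →
    iter ⟦ σ ⟧ x (toℕ n) ≟ˢ cycleRep σ (cycleOf σ x)} _

module _ (π τ : Perm) where

  private
    σ = π · τ
    f = next π [] τ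

  endClass : HalfEdge 0 → Fin (cycles σ)
  endClass (left x)  = cycleOf σ x
  endClass (right x) = cycleOf σ (⟦ π ⟧ x)

  endClass-next : ∀ d → endClass (f d) ≡ endClass d
  endClass-next (left x)  = trans (cong (cycleOf σ) (sym (⟦·⟧ π τ x))) (cycleOf-step σ x)
  endClass-next (right x) = refl

  iter-orbit : ∀ n x → SameOrbit f (left x) (left (iter ⟦ σ ⟧ x n))
  iter-orbit zero    x = ε
  iter-orbit (suc n) x = fwd refl ◅ fwd (cong left (sym (⟦·⟧ π τ x))) ◅ iter-orbit n (⟦ σ ⟧ x)

  toEndRep : ∀ d → SameOrbit f d (left (cycleRep σ (endClass d)))
  toEndRep (left x) with n , eq ← cycleRep-reach σ x =
    subst (λ y → SameOrbit f (left x) (left y)) eq (iter-orbit (toℕ n) x)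
  toEndRep (right x) = fwd refl ◅ toEndRep (left (⟦ π ⟧ x))

  -- Without rungs a face alternates between the two ends, and two of its steps, seen from the left
  -- end, are one step of `π · τ`.
  end-orbits : Orbits f (cycles σ)
  end-orbits = record
    { class          = endClass
    ; rep            = left ∘ cycleRep σ
    ; class-rep      = cycleOf-rep σ
    ; class-step     = endClass-next
    ; class-reflects = λ {d} {e} eq → toEndRep d ◅◅
        subst (λ c → SameOrbit f (left (cycleRep σ c)) e) (sym eq) (symmetric _ (toEndRep e))
    }

faceTotal : ∀ {m} → Perm → Rungs m → Perm → ℕ
faceTotal π []       τ = cycles (π · τ)
faceTotal π (r ∷ bs) τ = closed π r + faceTotal (absorb π r) bs τ

orbits : ∀ {m} π (bs : Rungs m) τ → Orbits (next π bs τ) (faceTotal π bs τ)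
orbits π []       τ = end-orbits π τ
orbits π (r ∷ bs) τ = absorb-orbits π r bs τ (orbits (absorb π r) bs τ)

cycles≤3 : ∀ σ → cycles σ ≤ 3
cycles≤3 = toWitness {a? = ∀Perm? λ σ → cycles σ ℕ.≤? 3} _

closed≤1 : ∀ π r → closed π r ≤ 1
closed≤1 = toWitness {a? = ∀Perm? λ π → ∀Rung? λ r → closed π r ℕ.≤? 1} _

-- This bound produces the zero constant terms of `b` and `d`: a solution with i = 0 would have too
-- many faces.
faceTotal≤ : ∀ {m} π (bs : Rungs m) τ → faceTotal π bs τ ≤ m + 3
faceTotal≤ π []       τ = cycles≤3 (π · τ)
faceTotal≤ π (r ∷ bs) τ = ℕ.+-mono-≤ (closed≤1 π r) (faceTotal≤ (absorb π r) bs τ)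

-- Recurrences for the genus polynomials

indicator : ℕ → ℕ → ℕ
indicator a b = if a ≡ᵇ b then 1 else 0

indicator-≢ : ∀ {a b} → a ≢ b → indicator a b ≡ 0
indicator-≢ {a} {b} a≢b with a ≡ᵇ b in eq
... | false = refl
... | true  = contradiction (ℕ.≡ᵇ⇒≡ a b (subst Bool.T (sym eq) _)) a≢b

sumRungs : ∀ {m} → (Rungs m → ℕ) → ℕ
sumRungs {zero}  f = f []
sumRungs {suc m} f =
  sumRungs (λ bs → f ((false , false) ∷ bs)) + sumRungs (λ bs → f ((false , true) ∷ bs)) +
  sumRungs (λ bs → f ((true , false) ∷ bs))  + sumRungs (λ bs → f ((true , true) ∷ bs))

sumRungs-cong : ∀ {m} {f g : Rungs m → ℕ} → (∀ bs → f bs ≡ g bs) → sumRungs f ≡ sumRungs g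
sumRungs-cong {zero}  f≗g = f≗g []
sumRungs-cong {suc m} f≗g = cong₂ _+_ (cong₂ _+_ (cong₂ _+_
  (sumRungs-cong λ bs → f≗g (_ ∷ bs)) (sumRungs-cong λ bs → f≗g (_ ∷ bs)))
  (sumRungs-cong λ bs → f≗g (_ ∷ bs))) (sumRungs-cong λ bs → f≗g (_ ∷ bs))

sumRungs-zero : ∀ {m} {f : Rungs m → ℕ} → (∀ bs → f bs ≡ 0) → sumRungs f ≡ 0
sumRungs-zero {zero}  f≗0 = f≗0 []
sumRungs-zero {suc m} f≗0 = cong₂ _+_ (cong₂ _+_ (cong₂ _+_
  (sumRungs-zero λ bs → f≗0 (_ ∷ bs)) (sumRungs-zero λ bs → f≗0 (_ ∷ bs)))
  (sumRungs-zero λ bs → f≗0 (_ ∷ bs))) (sumRungs-zero λ bs → f≗0 (_ ∷ bs))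

solutionsAt : ℕ → Perm → ℕ → ℕ → Perm → ℕ
solutionsAt m π i s τ = sumRungs {m} (λ bs → indicator (faceTotal π bs τ + 2 * i) s)

-- The number of choices of the rungs and of a rotation at the right end for
-- which the number F of faces satisfies F + 2 i = s.
solutions : ℕ → Perm → ℕ → ℕ → ℕ
solutions m π i s = solutionsAt m π i s cycle + solutionsAt m π i s cycle⁻¹

solutions-shift : ∀ m π i s → solutions m π (suc i) (2 + s) ≡ solutions m π i s
solutions-shift m π i s = cong₂ _+_ (shiftAt cycle) (shiftAt cycle⁻¹)
  where
  shift : ∀ F i → F + 2 * suc i ≡ 2 + (F + 2 * i)
  shift = solve-∀
  shiftAt : ∀ τ → solutionsAt m π (suc i) (2 + s) τ ≡ solutionsAt m π i s τ
  shiftAt τ = sumRungs-cong {m} λ bs →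
    cong (λ k → indicator k (2 + s)) (shift (faceTotal π bs τ) i)

solutions-overflow : ∀ m π {s} → 3 + m < s → solutions m π 0 s ≡ 0
solutions-overflow m π {s} 3+m<s =
  cong₂ _+_ (sumRungs-zero {m} (zeroAt cycle)) (sumRungs-zero {m} (zeroAt cycle⁻¹))
  where
  zeroAt : ∀ τ bs → indicator (faceTotal π bs τ + 0) s ≡ 0
  zeroAt τ bs = indicator-≢ λ eq → ℕ.<⇒≱ 3+m<s (begin
    s                       ≡⟨ eq ⟨
    faceTotal π bs τ + 0    ≡⟨ ℕ.+-identityʳ _ ⟩
    faceTotal π bs τ        ≤⟨ faceTotal≤ π bs τ ⟩
    m + 3                   ≡⟨ ℕ.+-comm m 3 ⟩
    3 + m                   ∎)
    where open ℕ.≤-Reasoning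

-- The genus polynomials with m rungs left, when the permutation that the part
-- already absorbed induces on the strands is a 3-cycle (a), the identity (b),
-- the exchange of the rails (c), or another transposition (d).
a b c d : ℕ → ℕ → ℕ
a zero    0             = 1
a zero    1             = 1
a zero    (suc (suc i)) = 0
a (suc m) i             = 2 * d m i + a m i + c m i
b zero    2             = 2
b zero    _             = 0
b (suc m) zero          = 0
b (suc m) (suc i)       = 4 * c m i
c zero    1             = 2
c zero    _             = 0
c (suc m) i             = 2 * b m i + 2 * c m i
d zero    1             = 2
d zero    _             = 0
d (suc m) zero          = 0
d (suc m) (suc i)       = 4 * a m i

polynomial : Perm → ℕ → ℕ → ℕ
polynomial ι       = b
polynomial swap-uv = c
polynomial swap-ul = d
polynomial swap-vl = d
polynomial cycle   = a
polynomial cycle⁻¹ = a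

-- This is 2 plus the number of cycles of the permutation; for a 3-cycle, which is what a vertex
-- gives, F + 2 i = 3 + m is Euler's formula. A rung that adds a cycle closes no face and keeps i, a
-- rung that preserves the number of cycles closes a face and keeps i, and a rung that removes a
-- cycle closes none and raises i by one. The last case is the index shift in `b` and `d`.
offset : Perm → ℕ
offset ι       = 5
offset swap-uv = 4
offset swap-ul = 4
offset swap-vl = 4
offset cycle   = 3
offset cycle⁻¹ = 3

solutions≡polynomial-zero : ∀ π i → solutions 0 π i (offset π + 0) ≡ polynomial π 0 i
solutions≡polynomial-zero ι       0 = refl
solutions≡polynomial-zero ι       1 = refl
solutions≡polynomial-zero ι       2 = refl
solutions≡polynomial-zero swap-uv 0 = refl
solutions≡polynomial-zero swap-uv 1 = refl
solutions≡polynomial-zero swap-ul 0 = refl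
solutions≡polynomial-zero swap-ul 1 = refl
solutions≡polynomial-zero swap-vl 0 = refl
solutions≡polynomial-zero swap-vl 1 = refl
solutions≡polynomial-zero cycle   0 = refl
solutions≡polynomial-zero cycle   1 = refl
solutions≡polynomial-zero cycle⁻¹ 0 = refl
solutions≡polynomial-zero cycle⁻¹ 1 = refl
solutions≡polynomial-zero ι       (suc (suc (suc i))) =
  trans (solutions-shift 0 ι (2 + i) 3) (solutions-shift 0 ι (1 + i) 1)
solutions≡polynomial-zero swap-uv (suc (suc i)) =
  trans (solutions-shift 0 swap-uv (suc i) 2) (solutions-shift 0 swap-uv i 0)
solutions≡polynomial-zero swap-ul (suc (suc i)) =
  trans (solutions-shift 0 swap-ul (suc i) 2) (solutions-shift 0 swap-ul i 0)
solutions≡polynomial-zero swap-vl (suc (suc i)) =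
  trans (solutions-shift 0 swap-vl (suc i) 2) (solutions-shift 0 swap-vl i 0)
solutions≡polynomial-zero cycle   (suc (suc i)) = solutions-shift 0 cycle (suc i) 1
solutions≡polynomial-zero cycle⁻¹ (suc (suc i)) = solutions-shift 0 cycle⁻¹ (suc i) 1

module _ (m : ℕ) where

  private
    sum₄ : (f₁ f₂ f₃ f₄ : Perm → ℕ) {x₁ x₂ x₃ x₄ : ℕ} →
           f₁ cycle + f₁ cycle⁻¹ ≡ x₁ → f₂ cycle + f₂ cycle⁻¹ ≡ x₂ →
           f₃ cycle + f₃ cycle⁻¹ ≡ x₃ → f₄ cycle + f₄ cycle⁻¹ ≡ x₄ →
           (f₁ cycle + f₂ cycle + f₃ cycle + f₄ cycle) +
           (f₁ cycle⁻¹ + f₂ cycle⁻¹ + f₃ cycle⁻¹ + f₄ cycle⁻¹) ≡ x₁ + x₂ + x₃ + x₄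
    sum₄ f₁ f₂ f₃ f₄ refl refl refl refl = interchange
      (f₁ cycle) (f₂ cycle) (f₃ cycle) (f₄ cycle) (f₁ cycle⁻¹) (f₂ cycle⁻¹) (f₃ cycle⁻¹) (f₄ cycle⁻¹)
      where
      interchange : ∀ p q r s p′ q′ r′ s′ → (p + q + r + s) + (p′ + q′ + r′ + s′) ≡
                    (p + p′) + (q + q′) + (r + r′) + (s + s′)
      interchange = solve-∀

    times-4 : ∀ x → x + x + x + x ≡ 4 * x
    times-4 = solve-∀

    b+c+c+b : ∀ x y → x + y + y + x ≡ 2 * x + 2 * y
    b+c+c+b = solve-∀

    d+a+c+d : ∀ x y z → x + y + z + x ≡ 2 * x + y + z
    d+a+c+d = solve-∀

    d+c+a+d : ∀ x y z → x + z + y + x ≡ 2 * x + y + z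
    d+c+a+d = solve-∀

  solutions≡polynomial-suc : (∀ π i → solutions m π i (offset π + m) ≡ polynomial π m i) →
    ∀ π i → solutions (suc m) π i (offset π + suc m) ≡ polynomial π (suc m) i
  solutions≡polynomial-suc ih ι zero = sum₄ f f f f zeros zeros zeros zeros
    where
    f = solutionsAt m swap-uv 0 (6 + m)
    zeros = solutions-overflow m swap-uv {6 + m} (ℕ.m≤n+m (4 + m) 2)
  solutions≡polynomial-suc ih ι (suc i) =
    trans (sum₄ f f f f shifted shifted shifted shifted) (times-4 (c m i))
    where
    f = solutionsAt m swap-uv (suc i) (6 + m)
    shifted = trans (solutions-shift m swap-uv i (4 + m)) (ih swap-uv i)
  -- The four terms follow the order of `sumRungs`. A face closed by the rung has been cancelled in
  -- `indicator` by evaluation, leaving `4 + m` in place of `5 + m`.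
  solutions≡polynomial-suc ih swap-uv i = trans
    (sum₄ (solutionsAt m ι i (5 + m)) (solutionsAt m swap-uv i (4 + m)) (solutionsAt m swap-uv i (4 + m)) (solutionsAt m ι i (5 + m))
      (ih ι i) (ih swap-uv i) (ih swap-uv i) (ih ι i)) (b+c+c+b (b m i) (c m i))
  solutions≡polynomial-suc ih swap-ul zero = sum₄ f f g g
    (solutions-overflow m cycle (ℕ.m≤n+m (4 + m) 1)) (solutions-overflow m cycle (ℕ.m≤n+m (4 + m) 1))
    (solutions-overflow m cycle⁻¹ (ℕ.m≤n+m (4 + m) 1)) (solutions-overflow m cycle⁻¹ (ℕ.m≤n+m (4 + m) 1))
    where
    f = solutionsAt m cycle 0 (5 + m)
    g = solutionsAt m cycle⁻¹ 0 (5 + m)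
  solutions≡polynomial-suc ih swap-ul (suc i) =
    trans (sum₄ f f g g f-shifted f-shifted g-shifted g-shifted) (times-4 (a m i))
    where
    f = solutionsAt m cycle (suc i) (5 + m)
    g = solutionsAt m cycle⁻¹ (suc i) (5 + m)
    f-shifted = trans (solutions-shift m cycle i (3 + m)) (ih cycle i)
    g-shifted = trans (solutions-shift m cycle⁻¹ i (3 + m)) (ih cycle⁻¹ i)
  solutions≡polynomial-suc ih swap-vl zero = sum₄ g f g f
    (solutions-overflow m cycle⁻¹ (ℕ.m≤n+m (4 + m) 1)) (solutions-overflow m cycle (ℕ.m≤n+m (4 + m) 1))
    (solutions-overflow m cycle⁻¹ (ℕ.m≤n+m (4 + m) 1)) (solutions-overflow m cycle (ℕ.m≤n+m (4 + m) 1))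
    where
    f = solutionsAt m cycle 0 (5 + m)
    g = solutionsAt m cycle⁻¹ 0 (5 + m)
  solutions≡polynomial-suc ih swap-vl (suc i) =
    trans (sum₄ g f g f g-shifted f-shifted g-shifted f-shifted) (times-4 (a m i))
    where
    f = solutionsAt m cycle (suc i) (5 + m)
    g = solutionsAt m cycle⁻¹ (suc i) (5 + m)
    f-shifted = trans (solutions-shift m cycle i (3 + m)) (ih cycle i)
    g-shifted = trans (solutions-shift m cycle⁻¹ i (3 + m)) (ih cycle⁻¹ i)
  solutions≡polynomial-suc ih cycle i = trans
    (sum₄ (solutionsAt m swap-ul i (4 + m)) (solutionsAt m cycle i (3 + m)) (solutionsAt m swap-uv i (4 + m)) (solutionsAt m swap-vl i (4 + m))
      (ih swap-ul i) (ih cycle i) (ih swap-uv i) (ih swap-vl i)) (d+a+c+d (d m i) (a m i) (c m i))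
  solutions≡polynomial-suc ih cycle⁻¹ i = trans
    (sum₄ (solutionsAt m swap-vl i (4 + m)) (solutionsAt m swap-uv i (4 + m)) (solutionsAt m cycle⁻¹ i (3 + m)) (solutionsAt m swap-ul i (4 + m))
      (ih swap-vl i) (ih swap-uv i) (ih cycle⁻¹ i) (ih swap-ul i)) (d+c+a+d (d m i) (a m i) (c m i))

solutions≡polynomial : ∀ m π i → solutions m π i (offset π + m) ≡ polynomial π m i
solutions≡polynomial zero    = solutions≡polynomial-zero
solutions≡polynomial (suc m) = solutions≡polynomial-suc m (solutions≡polynomial m)

-- Faces of a rotation system

rev-left-link : ∀ m → rev {m} (left link) ≡ right link
rev-left-link zero    = refl
rev-left-link (suc m) = cong far (rev-left-link m)

rev-right-link : ∀ m → rev {m} (right link) ≡ left link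
rev-right-link zero    = refl
rev-right-link (suc m) = cong far (rev-right-link m)

rev-right-rail : ∀ m s → rev {suc m} (right (rail s)) ≡ at s (fromℕ m) forth
rev-right-rail zero    s = refl
rev-right-rail (suc m) s = cong far (rev-right-rail m s)

rev-back : ∀ {m} s (i : Fin m) → rev (at s (suc i) back) ≡ at s (inject₁ i) forth
rev-back s zero    = refl
rev-back s (suc i) = cong far (rev-back s i)

rev-rung : ∀ {m} s (i : Fin m) → rev (at s i rung) ≡ at (other s) i rung
rev-rung s zero    = refl
rev-rung s (suc i) = cong far (rev-rung s i)

rev-last : ∀ m s → rev (at s (fromℕ m) forth) ≡ right (rail s)
rev-last m s = trans (cong rev (sym (rev-right-rail m s))) (rev-involutive (right (rail s)))

rev-forth : ∀ {m} s (i : Fin m) → rev (at s (inject₁ i) forth) ≡ at s (suc i) back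
rev-forth s i = trans (cong rev (sym (rev-back s i))) (rev-involutive (at s (suc i) back))

-- Three elements have two cyclic orders; the bit selects the reversed one, written with the same
-- first entry as in `cyclicOrders`.
arrange : {A : Set} → Bool → List A → List A
arrange true (x ∷ y ∷ z ∷ []) = x ∷ z ∷ y ∷ []
arrange _    xs               = xs

entry : {A : Set} → A → A → A → Dir → A
entry x y z back  = x
entry x y z forth = y
entry x y z rung  = z

endPerm : Bool → Perm
endPerm false = cycle
endPerm true  = cycle⁻¹

module _ {A : Set} (_≟_ : DecidableEquality A) where

  cyclicSuccessor₁ : ∀ x y z → cyclicSuccessor _≟_ (x ∷ y ∷ z ∷ []) x ≡ y
  cyclicSuccessor₁ x y z rewrite dec-true (x ≟ x) refl = refl

  cyclicSuccessor₂ : ∀ {x y} z → y ≢ x → cyclicSuccessor _≟_ (x ∷ y ∷ z ∷ []) y ≡ z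
  cyclicSuccessor₂ {x} {y} z y≢x rewrite dec-false (y ≟ x) y≢x | dec-true (y ≟ y) refl = refl

  cyclicSuccessor₃ : ∀ {x y z} → z ≢ x → z ≢ y → cyclicSuccessor _≟_ (x ∷ y ∷ z ∷ []) z ≡ x
  cyclicSuccessor₃ {x} {y} {z} z≢x z≢y
    rewrite dec-false (z ≟ x) z≢x | dec-false (z ≟ y) z≢y = refl

  cyclicSuccessor-arrange : ∀ {x y z} → Unique (x ∷ y ∷ z ∷ []) → ∀ t e →
    cyclicSuccessor _≟_ (arrange t (x ∷ y ∷ z ∷ [])) (entry x y z e) ≡ entry x y z (turn t e)
  cyclicSuccessor-arrange uniq                                 false back  = cyclicSuccessor₁ _ _ _
  cyclicSuccessor-arrange ((x≢y ∷ x≢z ∷ []) ∷ (y≢z ∷ []) ∷ _)  false forth =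
    cyclicSuccessor₂ _ (≢-sym x≢y)
  cyclicSuccessor-arrange ((x≢y ∷ x≢z ∷ []) ∷ (y≢z ∷ []) ∷ _)  false rung  =
    cyclicSuccessor₃ (≢-sym x≢z) (≢-sym y≢z)
  cyclicSuccessor-arrange uniq                                 true  back  = cyclicSuccessor₁ _ _ _
  cyclicSuccessor-arrange ((x≢y ∷ x≢z ∷ []) ∷ (y≢z ∷ []) ∷ _)  true  forth =
    cyclicSuccessor₃ (≢-sym x≢y) y≢z
  cyclicSuccessor-arrange ((x≢y ∷ x≢z ∷ []) ∷ (y≢z ∷ []) ∷ _)  true  rung  =
    cyclicSuccessor₂ _ (≢-sym x≢z)

module _ {m : ℕ} where

  private
    V = RLVertex (suc m)
    G = RL (suc m)

  vertexOn : Side → Fin (suc m) → V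
  vertexOn uˢ = u
  vertexOn vˢ = v

  source sink : HalfEdge (suc m) → V
  source (left x)        = w
  source (right x)       = w′
  source (at s i e)      = vertexOn s i
  sink (left (rail s))   = vertexOn s zero
  sink (left link)       = w′
  sink (right (rail s))  = vertexOn s (fromℕ m)
  sink (right link)      = w
  sink (at s i back)     = before (vertexOn s) i
  sink (at s i forth)    = after (vertexOn s) i
  sink (at s i rung)     = vertexOn (other s) i

  toDart : HalfEdge (suc m) → V × V
  toDart h = source h , sink h

  source-rev : ∀ h → source (rev h) ≡ sink h
  source-rev (left (rail s))  = refl
  source-rev (left link)      = cong source (rev-left-link (suc m))
  source-rev (right (rail s)) = cong source (rev-right-rail m s)
  source-rev (right link)     = cong source (rev-right-link (suc m))
  source-rev (at s zero back)    = refl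
  source-rev (at s (suc i) back) = cong source (rev-back s i)
  source-rev (at s i forth) with view i
  ... | ‵fromℕ     = cong source (rev-last m s)
  ... | ‵inject₁ j = cong source (rev-forth s j)
  source-rev (at s i rung) = cong source (rev-rung s i)

  sink-rev : ∀ h → sink (rev h) ≡ source h
  sink-rev h = trans (sym (source-rev (rev h))) (cong source (rev-involutive h))

  halfEdgesAt : V → List (HalfEdge (suc m))
  halfEdgesAt (u i) = at uˢ i back ∷ at uˢ i forth ∷ at uˢ i rung ∷ []
  halfEdgesAt (v i) = at vˢ i back ∷ at vˢ i forth ∷ at vˢ i rung ∷ []
  halfEdgesAt w     = left (rail uˢ) ∷ left (rail vˢ) ∷ left link ∷ []
  halfEdgesAt w′    = right (rail uˢ) ∷ right (rail vˢ) ∷ right link ∷ []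

  map-toDart : ∀ x → map toDart (halfEdgesAt x) ≡ map (x ,_) (RL-neighbours x)
  map-toDart (u i) = refl
  map-toDart (v i) = refl
  map-toDart w     = refl
  map-toDart w′    = refl

  ∈-halfEdgesAt : ∀ h → h ∈ halfEdgesAt (source h)
  ∈-halfEdgesAt (left (rail uˢ))  = here refl
  ∈-halfEdgesAt (left (rail vˢ))  = there (here refl)
  ∈-halfEdgesAt (left link)       = there (there (here refl))
  ∈-halfEdgesAt (right (rail uˢ)) = here refl
  ∈-halfEdgesAt (right (rail vˢ)) = there (here refl)
  ∈-halfEdgesAt (right link)      = there (there (here refl))
  ∈-halfEdgesAt (at uˢ i back)    = here refl
  ∈-halfEdgesAt (at uˢ i forth)   = there (here refl)
  ∈-halfEdgesAt (at uˢ i rung)    = there (there (here refl))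
  ∈-halfEdgesAt (at vˢ i back)    = here refl
  ∈-halfEdgesAt (at vˢ i forth)   = there (here refl)
  ∈-halfEdgesAt (at vˢ i rung)    = there (there (here refl))

  halfEdges : List (HalfEdge (suc m))
  halfEdges = concatMap halfEdgesAt us-vs-ws

  halfEdges-complete : ∀ h → h ∈ halfEdges
  halfEdges-complete h = ∈-concatMap⁺ halfEdgesAt
    (lose (us-vs-ws-complete (source h)) (∈-halfEdgesAt h))

  map-toDart-halfEdges : map toDart halfEdges ≡ darts G
  map-toDart-halfEdges = trans (map-concatMap toDart halfEdgesAt us-vs-ws)
    (concatMap-cong map-toDart us-vs-ws)

  toDart-injective : Injective _≡_ _≡_ toDart
  toDart-injective {h} {k} eq = Unique-map⇒injective
    (subst Unique (sym (map-toDart (source h)))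
      (Unique.map⁺ (cong proj₂) (RL-neighbours-unique (source h))))
    (∈-halfEdgesAt h) (subst (λ x → k ∈ halfEdgesAt x) (sym (cong proj₁ eq)) (∈-halfEdgesAt k)) eq

  -- Both ends list their neighbours in the order of the strands. A direction serves here as the
  -- name of a position in that list, so that `entry` and `turn` cover the ends as well as the
  -- rungs.
  dirOf : Strand → Dir
  dirOf (rail uˢ) = back
  dirOf (rail vˢ) = forth
  dirOf link      = rung

  sink-left : ∀ x → entry (u zero) (v zero) w′ (dirOf x) ≡ sink (left x)
  sink-left (rail uˢ) = refl
  sink-left (rail vˢ) = refl
  sink-left link      = refl

  sink-right : ∀ x → entry (u (fromℕ m)) (v (fromℕ m)) w (dirOf x) ≡ sink (right x)
  sink-right (rail uˢ) = refl
  sink-right (rail vˢ) = refl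
  sink-right link      = refl

  sink-u : ∀ i e → entry (before u i) (after u i) (v i) e ≡ sink (at uˢ i e)
  sink-u i back  = refl
  sink-u i forth = refl
  sink-u i rung  = refl

  sink-v : ∀ i e → entry (before v i) (after v i) (u i) e ≡ sink (at vˢ i e)
  sink-v i back  = refl
  sink-v i forth = refl
  sink-v i rung  = refl

  dirOf-endPerm : ∀ t x → turn t (dirOf x) ≡ dirOf (⟦ endPerm t ⟧ x)
  dirOf-endPerm false (rail uˢ) = refl
  dirOf-endPerm false (rail vˢ) = refl
  dirOf-endPerm false link      = refl
  dirOf-endPerm true  (rail uˢ) = refl
  dirOf-endPerm true  (rail vˢ) = refl
  dirOf-endPerm true  link      = refl

  bitAt : Bool → Rungs (suc m) → Bool → V → Bool
  bitAt l bs r (u i) = proj₁ (lookup bs i)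
  bitAt l bs r (v i) = proj₂ (lookup bs i)
  bitAt l bs r w     = l
  bitAt l bs r w′    = r

  module _ {ρ : RotationSystem G} {l : Bool} {bs : Rungs (suc m)} {r : Bool}
           (ρ≗ : ∀ x → ρ x ≡ arrange (bitAt l bs r x) (RL-neighbours x)) where

    private
      rotate = rot (endPerm l) bs (endPerm r)

    successor : ∀ x {p q s} → RL-neighbours x ≡ p ∷ q ∷ s ∷ [] → ∀ e →
      cyclicSuccessor _≟ᴿ_ (ρ x) (entry p q s e) ≡ entry p q s (turn (bitAt l bs r x) e)
    successor x {p} {q} {s} eq e rewrite ρ≗ x | eq = cyclicSuccessor-arrange _≟ᴿ_
      (subst Unique eq (RL-neighbours-unique x)) (bitAt l bs r x) e

    successor-end : ∀ x {p q s} → RL-neighbours x ≡ p ∷ q ∷ s ∷ [] → (end : Strand → HalfEdge (suc m)) →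
      (∀ y → entry p q s (dirOf y) ≡ sink (end y)) → ∀ y →
      cyclicSuccessor _≟ᴿ_ (ρ x) (sink (end y)) ≡ sink (end (⟦ endPerm (bitAt l bs r x) ⟧ y))
    successor-end x {p} {q} {s} eq end sink-end y = begin
      cyclicSuccessor _≟ᴿ_ (ρ x) (sink (end y))
        ≡⟨ cong (cyclicSuccessor _≟ᴿ_ (ρ x)) (sink-end y) ⟨
      cyclicSuccessor _≟ᴿ_ (ρ x) (entry p q s (dirOf y))      ≡⟨ successor x eq (dirOf y) ⟩
      entry p q s (turn (bitAt l bs r x) (dirOf y))
        ≡⟨ cong (entry p q s) (dirOf-endPerm (bitAt l bs r x) y) ⟩
      entry p q s (dirOf (⟦ endPerm (bitAt l bs r x) ⟧ y))    ≡⟨ sink-end (⟦ endPerm (bitAt l bs r x) ⟧ y) ⟩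
      sink (end (⟦ endPerm (bitAt l bs r x) ⟧ y))             ∎
      where open ≡-Reasoning

    sink-rotate : ∀ h → cyclicSuccessor _≟ᴿ_ (ρ (source h)) (sink h) ≡ sink (rotate h)
    sink-rotate (left x)    = successor-end w refl left sink-left x
    sink-rotate (right x)   = successor-end w′ refl right sink-right x
    sink-rotate (at uˢ i e) = trans (cong (cyclicSuccessor _≟ᴿ_ (ρ (u i))) (sym (sink-u i e)))
      (trans (successor (u i) refl e) (sink-u i _))
    sink-rotate (at vˢ i e) = trans (cong (cyclicSuccessor _≟ᴿ_ (ρ (v i))) (sym (sink-v i e)))
      (trans (successor (v i) refl e) (sink-v i _))

    source-rotate : ∀ h → source (rotate h) ≡ source h
    source-rotate (left x)   = refl
    source-rotate (right x)  = refl
    source-rotate (at s i e) = refl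

    -- `traceStep` uses the rotation at the head of a dart; the reversed half-edge starts at that
    -- head and points back to the tail.
    toDart-next : ∀ h → toDart (next (endPerm l) bs (endPerm r) h) ≡ traceStep G ρ (toDart h)
    toDart-next h = cong₂ _,_ (trans (source-rotate (rev h)) (source-rev h)) (begin
      sink (rotate (rev h))                                        ≡⟨ sink-rotate (rev h) ⟨
      cyclicSuccessor _≟ᴿ_ (ρ (source (rev h))) (sink (rev h))
        ≡⟨ cong₂ (λ x → cyclicSuccessor _≟ᴿ_ (ρ x)) (source-rev h) (sink-rev h) ⟩
      cyclicSuccessor _≟ᴿ_ (ρ (sink h)) (source h)                  ∎)
      where open ≡-Reasoning

    faceCount≡faceTotal : faceCount G ρ ≡ faceTotal (endPerm l) bs (endPerm r)
    faceCount≡faceTotal = length-deduplicate-orbits {h = traceStep G ρ}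
      (orbits (endPerm l) bs (endPerm r)) (next-injective (endPerm l) bs (endPerm r))
      halfEdges-complete toDart toDart-injective toDart-next map-toDart-halfEdges
      (λ x y → y ∈? faceOf G ρ x)
      where open DecMembership (≡-dec _≟ᴿ_ _≟ᴿ_) using (_∈?_)

  -- Euler's formula for the Ringel ladder

  vertexCount-RL : vertexCount G ≡ 2 * suc m + 2
  vertexCount-RL = begin
    length (us-vs-ws {suc m})                                  ≡⟨ length-++ (map u (allFin (suc m))) ⟩
    length (map u (allFin (suc m))) + length (vs-ws {suc m})
      ≡⟨ cong₂ _+_ (lengthOf u) (length-++ (map v (allFin (suc m)))) ⟩
    suc m + (length (map v (allFin (suc m))) + 2)              ≡⟨ cong (λ k → suc m + (k + 2)) (lengthOf v) ⟩
    suc m + (suc m + 2)                                        ≡⟨ arithmetic (suc m) ⟩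
    2 * suc m + 2                                              ∎
    where
    open ≡-Reasoning
    lengthOf : ∀ (f : Fin (suc m) → V) → length (map f (allFin (suc m))) ≡ suc m
    lengthOf f = trans (length-map f (allFin (suc m))) (length-tabulate {n = suc m} id)
    arithmetic : ∀ n → n + (n + 2) ≡ 2 * n + 2
    arithmetic = solve-∀

  edgeCount-RL : edgeCount G ≡ 3 * suc m + 3
  edgeCount-RL = begin
    length (darts G) / 2                ≡⟨ cong (_/ 2) (length-darts (us-vs-ws {suc m})) ⟩
    (vertexCount G * 3) / 2             ≡⟨ cong (λ k → (k * 3) / 2) vertexCount-RL ⟩
    ((2 * suc m + 2) * 3) / 2           ≡⟨ cong (_/ 2) (arithmetic (suc m)) ⟩
    ((3 * suc m + 3) * 2) / 2           ≡⟨ m*n/n≡m (3 * suc m + 3) 2 ⟩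
    3 * suc m + 3                       ∎
    where
    open ≡-Reasoning
    arithmetic : ∀ n → (2 * n + 2) * 3 ≡ (3 * n + 3) * 2
    arithmetic = solve-∀
    length-dartsAt : ∀ (x : V) → length (map (x ,_) (RL-neighbours x)) ≡ 3
    length-dartsAt (u i) = refl
    length-dartsAt (v i) = refl
    length-dartsAt w     = refl
    length-dartsAt w′    = refl
    length-darts : ∀ (xs : List V) → length (concatMap (λ x → map (x ,_) (RL-neighbours x)) xs) ≡ length xs * 3
    length-darts []       = refl
    length-darts (x ∷ xs) = trans (length-++ (map (x ,_) (RL-neighbours x)))
      (cong₂ _+_ (length-dartsAt x) (length-darts xs))

  hasGenus-RL : ∀ {ρ F} i → faceCount G ρ ≡ F → HasGenus G i ρ ⇔ (F + 2 * i ≡ 3 + suc m)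
  hasGenus-RL {ρ} {F} i refl = mk⇔
    (λ eq → ℕ.+-cancelˡ-≡ (2 * suc m + 2) _ _ (trans (sym euler) (trans eq edges)))
    (λ eq → trans euler (trans (cong (2 * suc m + 2 +_) eq) (sym edges)))
    where
    euler : vertexCount G + F + 2 * i ≡ 2 * suc m + 2 + (F + 2 * i)
    euler = trans (ℕ.+-assoc (vertexCount G) F (2 * i)) (cong (_+ (F + 2 * i)) vertexCount-RL)
    arithmetic : ∀ n → 3 * n + 3 + 2 ≡ 2 * n + 2 + (3 + n)
    arithmetic = solve-∀
    edges : edgeCount G + 2 ≡ 2 * suc m + 2 + (3 + suc m)
    edges = trans (cong (_+ 2) edgeCount-RL) (arithmetic (suc m))

-- Enumeration of the rotation systems

indicator-refl : ∀ k → indicator k k ≡ 1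
indicator-refl zero    = refl
indicator-refl (suc k) = indicator-refl k

-- Abstract, so that no list of rotation systems is unfolded during conversion
-- checking.
abstract
  count : {A : Set} {P : A → Set} → (∀ x → Dec (P x)) → List A → ℕ
  count P? xs = length (filter P? xs)

  count-def : {A : Set} {P : A → Set} (P? : ∀ x → Dec (P x)) → ∀ xs →
    length (filter P? xs) ≡ count P? xs
  count-def P? xs = refl

  count-++ : {A : Set} {P : A → Set} (P? : ∀ x → Dec (P x)) → ∀ xs ys →
    count P? (xs ++ ys) ≡ count P? xs + count P? ys
  count-++ P? xs ys = trans (cong length (filter-++ P? xs ys)) (length-++ (filter P? xs))

  count-map : {A B : Set} {P : A → Set} (P? : ∀ x → Dec (P x)) (f : B → A) → ∀ xs →
    count P? (map f xs) ≡ count (λ x → P? (f x)) xs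
  count-map P? f xs = trans
    (cong length (sym (map-filter-⇔ (λ x → P? (f x)) P? f (λ _ → mk⇔ id id) xs)))
    (length-map f (filter (λ x → P? (f x)) xs))

  count-[x] : {A : Set} {P : A → Set} (P? : ∀ x → Dec (P x)) → ∀ x {k l} →
    P x ⇔ (k ≡ l) → count P? (x ∷ []) ≡ indicator k l
  count-[x] P? x {k} P⇔ with P? x
  ... | yes p with refl ← Equivalence.to P⇔ p = sym (indicator-refl k)
  ... | no ¬p = sym (indicator-≢ (¬p ∘ Equivalence.from P⇔))

sumBits : ∀ {k} → (Vec Bool k → ℕ) → ℕ
sumBits {zero}  f = f []
sumBits {suc k} f = sumBits (λ bs → f (false ∷ bs)) + sumBits (λ bs → f (true ∷ bs))

sumBits-cong : ∀ {k} {f g : Vec Bool k → ℕ} → (∀ bs → f bs ≡ g bs) → sumBits f ≡ sumBits g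
sumBits-cong {zero}  f≗g = f≗g []
sumBits-cong {suc k} f≗g =
  cong₂ _+_ (sumBits-cong λ bs → f≗g (_ ∷ bs)) (sumBits-cong λ bs → f≗g (_ ∷ bs))

interchange₂ : ∀ p q p′ q′ → (p + q) + (p′ + q′) ≡ (p + p′) + (q + q′)
interchange₂ = solve-∀

sumBits-+ : ∀ k (f g : Vec Bool k → ℕ) → sumBits (λ bs → f bs + g bs) ≡ sumBits f + sumBits g
sumBits-+ zero    f g = refl
sumBits-+ (suc k) f g = trans
  (cong₂ _+_ (sumBits-+ k (λ bs → f (false ∷ bs)) (λ bs → g (false ∷ bs)))
             (sumBits-+ k (λ bs → f (true ∷ bs)) (λ bs → g (true ∷ bs))))
  (interchange₂ (sumBits (λ bs → f (false ∷ bs))) (sumBits (λ bs → g (false ∷ bs)))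
                (sumBits (λ bs → f (true ∷ bs))) (sumBits (λ bs → g (true ∷ bs))))

-- The enumeration treats all the vertices u before the vertices v, whereas absorption needs both
-- bits of a rung at once.
sumBits-zip : ∀ k (f : Rungs k → ℕ) →
  sumBits (λ us → sumBits (λ vs → f (zip us vs))) ≡ sumRungs f
sumBits-zip zero    f = refl
sumBits-zip (suc k) f = trans (cong₂ _+_ (half false) (half true))
  (sym (ℕ.+-assoc (sumRungs (λ bs → f ((false , false) ∷ bs)) + sumRungs (λ bs → f ((false , true) ∷ bs))) _ _))
  where
  half : ∀ s → sumBits (λ us → sumBits (λ vs → f ((s , false) ∷ zip us vs)) +
                               sumBits (λ vs → f ((s , true) ∷ zip us vs))) ≡
               sumRungs (λ bs → f ((s , false) ∷ bs)) + sumRungs (λ bs → f ((s , true) ∷ bs))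
  half s = trans
    (sumBits-+ k (λ us → sumBits (λ vs → f ((s , false) ∷ zip us vs)))
                 (λ us → sumBits (λ vs → f ((s , true) ∷ zip us vs))))
    (cong₂ _+_ (sumBits-zip k (λ bs → f ((s , false) ∷ bs))) (sumBits-zip k (λ bs → f ((s , true) ∷ bs))))

sumRungs-+ : ∀ m (f g : Rungs m → ℕ) → sumRungs (λ bs → f bs + g bs) ≡ sumRungs f + sumRungs g
sumRungs-+ zero    f g = refl
sumRungs-+ (suc m) f g = trans
  (cong₂ _+_ (cong₂ _+_ (cong₂ _+_ (part false false) (part false true)) (part true false)) (part true true))
  (arithmetic (at′ f false false) (at′ f false true) (at′ f true false) (at′ f true true)
              (at′ g false false) (at′ g false true) (at′ g true false) (at′ g true true))
  where
  at′ : (Rungs (suc m) → ℕ) → Bool → Bool → ℕ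
  at′ h s t = sumRungs (λ bs → h ((s , t) ∷ bs))
  part : ∀ s t → sumRungs (λ bs → f ((s , t) ∷ bs) + g ((s , t) ∷ bs)) ≡ at′ f s t + at′ g s t
  part s t = sumRungs-+ m (λ bs → f ((s , t) ∷ bs)) (λ bs → g ((s , t) ∷ bs))
  arithmetic : ∀ p q r s p′ q′ r′ s′ → (p + p′) + (q + q′) + (r + r′) + (s + s′) ≡
               (p + q + r + s) + (p′ + q′ + r′ + s′)
  arithmetic = solve-∀

sumBits-sumRungs : ∀ {n} {f : Vec Bool n → ℕ} {g : Vec Bool n → Vec Bool n → ℕ} {h : Rungs n → ℕ} →
  (∀ us → f us ≡ sumBits (g us)) → (∀ us vs → g us vs ≡ h (zip us vs)) → sumBits f ≡ sumRungs h
sumBits-sumRungs {n} {h = h} f≗ g≗ = trans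
  (sumBits-cong λ us → trans (f≗ us) (sumBits-cong (g≗ us))) (sumBits-zip n h)

faceIndicator : ∀ {n} → ℕ → Bool → Bool → Rungs n → ℕ
faceIndicator {n} i l r bs = indicator (faceTotal (endPerm l) bs (endPerm r) + 2 * i) (3 + n)

faceIndicators : ∀ {n} → ℕ → Rungs n → ℕ
faceIndicators i bs = (faceIndicator i false false bs + faceIndicator i false true bs) +
                      (faceIndicator i true false bs + faceIndicator i true true bs)

-- The two rotations at w give a 3-cycle and its inverse, which have the same polynomial; hence the
-- factor 2.
sumRungs-faceIndicators : ∀ n i → sumRungs {n} (faceIndicators i) ≡ 2 * a n i
sumRungs-faceIndicators n i = begin
  sumRungs {n} (faceIndicators i)
    ≡⟨ sumRungs-+ n (λ bs → ind false false bs + ind false true bs) (λ bs → ind true false bs + ind true true bs) ⟩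
  sumRungs (λ bs → ind false false bs + ind false true bs) + sumRungs (λ bs → ind true false bs + ind true true bs)
    ≡⟨ cong₂ _+_ (sumRungs-+ n (ind false false) (ind false true)) (sumRungs-+ n (ind true false) (ind true true)) ⟩
  solutions n cycle i (3 + n) + solutions n cycle⁻¹ i (3 + n)
    ≡⟨ cong₂ _+_ (solutions≡polynomial n cycle i) (solutions≡polynomial n cycle⁻¹ i) ⟩
  a n i + a n i
    ≡⟨ cong (a n i +_) (ℕ.+-identityʳ (a n i)) ⟨
  2 * a n i
    ∎
  where
  open ≡-Reasoning
  ind : Bool → Bool → Rungs n → ℕ
  ind = faceIndicator i

module _ {m : ℕ} where

  private
    V = RLVertex (suc m)
    G = RL (suc m)

  rotationAt : V → Bool → List V
  rotationAt x t = arrange t (RL-neighbours x)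

  cyclicOrders-neighbours : ∀ x → cyclicOrders (RL-neighbours x) ≡
                                  rotationAt x false ∷ rotationAt x true ∷ []
  cyclicOrders-neighbours (u i) = refl
  cyclicOrders-neighbours (v i) = refl
  cyclicOrders-neighbours w     = refl
  cyclicOrders-neighbours w′    = refl

  set : V → Bool → RotationSystem G → RotationSystem G
  set x t = assign G x (rotationAt x t)

  set-≡ : ∀ x t ρ → set x t ρ x ≡ rotationAt x t
  set-≡ x t ρ rewrite dec-true (x ≟ᴿ x) refl = refl

  set-≢ : ∀ {x y} t ρ → x ≢ y → set x t ρ y ≡ ρ y
  set-≢ {x} {y} t ρ x≢y rewrite dec-false (x ≟ᴿ y) x≢y = refl

  -- Rotation systems are functions. Moving the assignment into the predicate avoids any equality
  -- between them.
  count-set : ∀ {P : RotationSystem G → Set} (P? : ∀ ρ → Dec (P ρ)) x xs →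
    count P? (rotationSystemsOn G (x ∷ xs)) ≡
    count (λ ρ → P? (set x false ρ)) (rotationSystemsOn G xs) +
    count (λ ρ → P? (set x true ρ)) (rotationSystemsOn G xs)
  count-set P? x xs = begin
    count P? (cartesianProductWith (assign G x) (cyclicOrders (RL-neighbours x)) ρs)
      ≡⟨ cong (λ os → count P? (cartesianProductWith (assign G x) os ρs)) (cyclicOrders-neighbours x) ⟩
    count P? (map (set x false) ρs ++ map (set x true) ρs ++ [])
      ≡⟨ count-++ P? (map (set x false) ρs) _ ⟩
    count P? (map (set x false) ρs) + count P? (map (set x true) ρs ++ [])
      ≡⟨ cong (λ zs → count P? (map (set x false) ρs) + count P? zs) (++-identityʳ (map (set x true) ρs)) ⟩
    count P? (map (set x false) ρs) + count P? (map (set x true) ρs)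
      ≡⟨ cong₂ _+_ (count-map P? (set x false) ρs) (count-map P? (set x true) ρs) ⟩
    count (λ ρ → P? (set x false ρ)) ρs + count (λ ρ → P? (set x true ρ)) ρs
      ∎
    where
    open ≡-Reasoning
    ρs = rotationSystemsOn G xs

  setAll : ∀ {k} → (Fin k → V) → Vec Bool k → RotationSystem G → RotationSystem G
  setAll f []       ρ = ρ
  setAll f (t ∷ ts) ρ = set (f zero) t (setAll (f ∘ suc) ts ρ)

  setAll-∈ : ∀ {k} {f : Fin k → V} → Injective _≡_ _≡_ f → ∀ ts ρ j →
             setAll f ts ρ (f j) ≡ rotationAt (f j) (lookup ts j)
  setAll-∈ {f = f} inj (t ∷ ts) ρ zero    = set-≡ (f zero) t (setAll (f ∘ suc) ts ρ)
  setAll-∈ {f = f} inj (t ∷ ts) ρ (suc j) = trans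
    (set-≢ t (setAll (f ∘ suc) ts ρ) λ eq → contradiction (inj eq) λ ())
    (setAll-∈ (Fin.suc-injective ∘ inj) ts ρ j)

  setAll-∉ : ∀ {k} {f : Fin k → V} {y} → (∀ j → f j ≢ y) → ∀ ts ρ → setAll f ts ρ y ≡ ρ y
  setAll-∉ f≢y []       ρ = refl
  setAll-∉ {f = f} f≢y (t ∷ ts) ρ = trans (set-≢ t (setAll (f ∘ suc) ts ρ) (f≢y zero)) (setAll-∉ (f≢y ∘ suc) ts ρ)

  count-setAll : ∀ {k} (f : Fin k → Fin (suc m)) (s : Fin (suc m) → V) xs
    {P : RotationSystem G → Set} (P? : ∀ ρ → Dec (P ρ)) →
    count P? (rotationSystemsOn G (map s (tabulate f) ++ xs)) ≡
    sumBits {k} (λ ts → count (λ ρ → P? (setAll (s ∘ f) ts ρ)) (rotationSystemsOn G xs))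
  count-setAll {zero}  f s xs P? = refl
  count-setAll {suc k} f s xs P? = trans
    (count-set P? (s (f zero)) (map s (tabulate (f ∘ suc)) ++ xs))
    (cong₂ _+_ (count-setAll (f ∘ suc) s xs (λ ρ → P? (set (s (f zero)) false ρ)))
               (count-setAll (f ∘ suc) s xs (λ ρ → P? (set (s (f zero)) true ρ))))

  system : Vec Bool (suc m) → Vec Bool (suc m) → Bool → Bool → RotationSystem G
  system us vs l r = setAll u us (setAll v vs (set w l (set w′ r (const []))))

  system-rotations : ∀ us vs l r x →
    system us vs l r x ≡ arrange (bitAt l (zip us vs) r x) (RL-neighbours x)
  system-rotations us vs l r (u i) = trans (setAll-∈ u-injective us _ i)
    (cong (rotationAt (u i)) (cong proj₁ (sym (lookup-zip i us vs))))
  system-rotations us vs l r (v i) = trans (setAll-∉ (λ _ ()) us _)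
    (trans (setAll-∈ v-injective vs _ i)
      (cong (rotationAt (v i)) (cong proj₂ (sym (lookup-zip i us vs)))))
  system-rotations us vs l r w  = trans (setAll-∉ (λ _ ()) us _) (trans (setAll-∉ (λ _ ()) vs _)
    (set-≡ w l (set w′ r (const []))))
  system-rotations us vs l r w′ = trans (setAll-∉ (λ _ ()) us _) (trans (setAll-∉ (λ _ ()) vs _)
    (trans (set-≢ {w} {w′} l (set w′ r (const [])) λ ()) (set-≡ w′ r (const []))))

  sumEnds : (Bool → Bool → ℕ) → ℕ
  sumEnds f = (f false false + f false true) + (f true false + f true true)

  module _ {P : RotationSystem G → Set} (P? : ∀ ρ → Dec (P ρ))
           (f : Rungs (suc m) → Bool → Bool → ℕ) {k : ℕ}
           (P⇔ : ∀ us vs l r → P (system us vs l r) ⇔ (f (zip us vs) l r ≡ k)) where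

    count-ends : ∀ us vs →
      count (λ ρ → P? (setAll u us (setAll v vs ρ))) (rotationSystemsOn G (w ∷ w′ ∷ [])) ≡
      sumEnds (λ l r → indicator (f (zip us vs) l r) k)
    count-ends us vs = trans (count-set (λ ρ → P? (setAll u us (setAll v vs ρ))) w (w′ ∷ []))
      (cong₂ _+_ (end false) (end true))
      where
      end : ∀ l → count (λ ρ → P? (setAll u us (setAll v vs (set w l ρ)))) (rotationSystemsOn G (w′ ∷ []))
        ≡ indicator (f (zip us vs) l false) k + indicator (f (zip us vs) l true) k
      end l = trans (count-set (λ ρ → P? (setAll u us (setAll v vs (set w l ρ)))) w′ [])
        (cong₂ _+_ (count-system false) (count-system true))
        where
        count-system : ∀ r → count (λ ρ → P? (setAll u us (setAll v vs (set w l (set w′ r ρ))))) (const [] ∷ [])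
          ≡ indicator (f (zip us vs) l r) k
        count-system r = count-[x] (λ ρ → P? (setAll u us (setAll v vs (set w l (set w′ r ρ)))))
          (const []) (P⇔ us vs l r)

    count-rotationSystems : count P? (rotationSystems G) ≡
                            sumRungs (λ bs → sumEnds (λ l r → indicator (f bs l r) k))
    count-rotationSystems = trans (count-setAll id u (vs-ws {suc m}) P?)
      (sumBits-sumRungs {h = λ bs → sumEnds (λ l r → indicator (f bs l r) k)}
        (λ us → count-setAll id v (w ∷ w′ ∷ []) (λ ρ → P? (setAll u us ρ))) count-ends)

genusCount-RL : ∀ n .{{_ : NonZero n}} i → genusCount (RL n) i ≡ 2 * a n i
genusCount-RL (suc m) i = begin
  genusCount (RL (suc m)) i
    ≡⟨ count-def (hasGenus? (RL (suc m)) i) (rotationSystems (RL (suc m))) ⟩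
  count (hasGenus? (RL (suc m)) i) (rotationSystems (RL (suc m)))
    ≡⟨ count-rotationSystems (hasGenus? (RL (suc m)) i)
         (λ bs l r → faceTotal (endPerm l) bs (endPerm r) + 2 * i) {3 + suc m}
         (λ us vs l r → hasGenus-RL {ρ = system us vs l r} i
           (faceCount≡faceTotal {l = l} {zip us vs} {r} (system-rotations us vs l r))) ⟩
  sumRungs {suc m} (faceIndicators i)
    ≡⟨ sumRungs-faceIndicators (suc m) i ⟩
  2 * a (suc m) i
    ∎
  where open ≡-Reasoning

-- Coefficients of the genus polynomials

-- Eliminating `d` and `b` gives a_(n+2) = a_(n+1) + c_(n+1) + 8 x a_n and c_(n+2) = 2 c_(n+1) + 8 x
-- c_n. Hence a - c satisfies y_(n+2) = y_(n+1) + 8 x y_n, with initial terms 1 - x and (1 - x)(1 +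
-- 4 x); `Q` is the quotient by 1 - x.
Q : ℕ → ℕ → ℕ
Q 0             zero          = 1
Q 0             (suc i)       = 0
Q 1             zero          = 1
Q 1             (suc zero)    = 4
Q 1             (suc (suc i)) = 0
Q (suc (suc n)) zero          = Q (suc n) zero
Q (suc (suc n)) (suc i)       = Q (suc n) (suc i) + 8 * Q n i

c-zero : ∀ n → c n 0 ≡ 0
c-zero zero          = refl
c-zero (suc zero)    = refl
c-zero (suc (suc n)) = cong (2 *_) (c-zero (suc n))

a-Q-zero : ∀ n → a n 0 ≡ Q n 0
a-Q-zero zero          = refl
a-Q-zero (suc zero)    = refl
a-Q-zero (suc (suc n)) = trans (cong₂ _+_ (a-Q-zero (suc n)) (c-zero (suc n))) (ℕ.+-identityʳ _)

Q-zero : ∀ n → Q n 0 ≡ 1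
Q-zero zero          = refl
Q-zero (suc zero)    = refl
Q-zero (suc (suc n)) = Q-zero (suc n)

-- As polynomials in x, a n = c n + (1 - x) Q n.
a-Q : ∀ n i → a n (suc i) + Q n i ≡ c n (suc i) + Q n (suc i)
a-Q zero       zero          = refl
a-Q zero       (suc i)       = refl
a-Q (suc zero) zero          = refl
a-Q (suc zero) (suc zero)    = refl
a-Q (suc zero) (suc (suc i)) = refl
a-Q (suc (suc n)) zero = begin
  (2 * (4 * a n 0) + a (suc n) 1 + c (suc n) 1) + Q (suc n) 0
    ≡⟨ rearrange (a n 0) (a (suc n) 1) (c (suc n) 1) (Q (suc n) 0) ⟩
  8 * a n 0 + (a (suc n) 1 + Q (suc n) 0) + c (suc n) 1
    ≡⟨ cong₂ (λ x y → 8 * x + y + c (suc n) 1) (a-Q-zero n) (a-Q (suc n) 0) ⟩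
  8 * Q n 0 + (c (suc n) 1 + Q (suc n) 1) + c (suc n) 1
    ≡⟨ collect (Q n 0) (c (suc n) 1) (Q (suc n) 1) ⟩
  (2 * (4 * 0) + 2 * c (suc n) 1) + (Q (suc n) 1 + 8 * Q n 0)
    ≡⟨ cong (λ x → 2 * (4 * x) + 2 * c (suc n) 1 + (Q (suc n) 1 + 8 * Q n 0)) (c-zero n) ⟨
  (2 * (4 * c n 0) + 2 * c (suc n) 1) + (Q (suc n) 1 + 8 * Q n 0)
    ∎
  where
  open ≡-Reasoning
  rearrange : ∀ w x y z → (2 * (4 * w) + x + y) + z ≡ 8 * w + (x + z) + y
  rearrange = solve-∀
  collect : ∀ x y z → 8 * x + (y + z) + y ≡ (2 * (4 * 0) + 2 * y) + (z + 8 * x)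
  collect = solve-∀
a-Q (suc (suc n)) (suc i) = begin
  (2 * (4 * a n (suc i)) + a (suc n) (2 + i) + c (suc n) (2 + i)) + (Q (suc n) (suc i) + 8 * Q n i)
    ≡⟨ rearrange (a n (suc i)) (a (suc n) (2 + i)) (c (suc n) (2 + i)) (Q (suc n) (suc i)) (Q n i) ⟩
  8 * (a n (suc i) + Q n i) + (a (suc n) (2 + i) + Q (suc n) (suc i)) + c (suc n) (2 + i)
    ≡⟨ cong₂ (λ x y → 8 * x + y + c (suc n) (2 + i)) (a-Q n i) (a-Q (suc n) (suc i)) ⟩
  8 * (c n (suc i) + Q n (suc i)) + (c (suc n) (2 + i) + Q (suc n) (2 + i)) + c (suc n) (2 + i)
    ≡⟨ collect (c n (suc i)) (Q n (suc i)) (c (suc n) (2 + i)) (Q (suc n) (2 + i)) ⟩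
  (2 * (4 * c n (suc i)) + 2 * c (suc n) (2 + i)) + (Q (suc n) (2 + i) + 8 * Q n (suc i))
    ∎
  where
  open ≡-Reasoning
  rearrange : ∀ p q r s t → (2 * (4 * p) + q + r) + (s + 8 * t) ≡ 8 * (p + t) + (q + s) + r
  rearrange = solve-∀
  collect : ∀ p q r s → 8 * (p + q) + (r + s) + r ≡ (2 * (4 * p) + 2 * r) + (s + 8 * q)
  collect = solve-∀

-- Pascal's rule with boundary values 2 and 1, the (2,1)-Pascal triangle: for i + j > 0 the value is
-- binom(i+j, i) + binom(i+j-1, i).
T : ℕ → ℕ → ℕ
T zero    zero    = 1
T zero    (suc j) = 2
T (suc i) zero    = 1
T (suc i) (suc j) = T i (suc j) + T (suc i) j

T-zero : ∀ i → T i 0 ≡ 1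
T-zero zero    = refl
T-zero (suc i) = refl

1≤T : ∀ i j → 1 ≤ T i j
1≤T zero    zero    = s≤s z≤n
1≤T zero    (suc j) = s≤s z≤n
1≤T (suc i) zero    = s≤s z≤n
1≤T (suc i) (suc j) = ℕ.≤-trans (1≤T i (suc j)) (ℕ.m≤m+n _ _)

T-! : ∀ i j → T i (suc j) * (i ! * suc j !) ≡ (i + 2 * suc j) * (i + j) !
T-! zero j = base j (j !)
  where
  base : ∀ j f → 2 * (1 * (suc j * f)) ≡ (2 * suc j) * f
  base = solve-∀
T-! (suc i) zero = begin
  (T i 1 + 1) * (suc i ! * 1)                       ≡⟨ expand i (T i 1) (i !) ⟩
  suc i * (T i 1 * (i ! * 1)) + suc i * i !         ≡⟨ cong (λ x → suc i * x + suc i * i !) (T-! i 0) ⟩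
  suc i * ((i + 2) * (i + 0) !) + suc i * i !
    ≡⟨ cong (λ k → suc i * ((i + 2) * k !) + suc i * i !) (ℕ.+-identityʳ i) ⟩
  suc i * ((i + 2) * i !) + suc i * i !             ≡⟨ collect i (i !) ⟩
  (suc i + 2) * suc i !                             ≡⟨ cong (λ k → (suc i + 2) * suc k !) (ℕ.+-identityʳ i) ⟨
  (suc i + 2) * suc (i + 0) !                       ∎
  where
  open ≡-Reasoning
  expand : ∀ i t f → (t + 1) * ((suc i * f) * 1) ≡ suc i * (t * (f * 1)) + suc i * f
  expand = solve-∀
  collect : ∀ i f → suc i * ((i + 2) * f) + suc i * f ≡ (suc i + 2) * (suc i * f)
  collect = solve-∀
T-! (suc i) (suc j) = begin
  (T i (2 + j) + T (suc i) (suc j)) * (suc i ! * (2 + j) !)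
    ≡⟨ expand i j (T i (2 + j)) (T (suc i) (suc j)) (i !) (suc j !) ⟩
  suc i * (T i (2 + j) * (i ! * (2 + j) !)) + (2 + j) * (T (suc i) (suc j) * (suc i ! * suc j !))
    ≡⟨ cong₂ (λ x y → suc i * x + (2 + j) * y) (T-! i (suc j)) (T-! (suc i) j) ⟩
  suc i * ((i + 2 * (2 + j)) * (i + suc j) !) + (2 + j) * ((suc i + 2 * suc j) * suc (i + j) !)
    ≡⟨ cong (λ k → suc i * ((i + 2 * (2 + j)) * k !) + (2 + j) * ((suc i + 2 * suc j) * suc (i + j) !)) (ℕ.+-suc i j) ⟩
  suc i * ((i + 2 * (2 + j)) * suc (i + j) !) + (2 + j) * ((suc i + 2 * suc j) * suc (i + j) !)
    ≡⟨ collect i j (suc (i + j) !) ⟩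
  (suc i + 2 * (2 + j)) * (suc (suc (i + j)) * suc (i + j) !)
    ≡⟨ cong (λ k → (suc i + 2 * (2 + j)) * suc k !) (ℕ.+-suc i j) ⟨
  (suc i + 2 * (2 + j)) * suc (i + suc j) !
    ∎
  where
  open ≡-Reasoning
  expand : ∀ i j s t f g → (s + t) * ((suc i * f) * ((2 + j) * g)) ≡
           suc i * (s * (f * ((2 + j) * g))) + (2 + j) * (t * ((suc i * f) * g))
  expand = solve-∀
  collect : ∀ i j f → suc i * ((i + 2 * (2 + j)) * f) + (2 + j) * ((suc i + 2 * suc j) * f) ≡
            (suc i + 2 * (2 + j)) * (suc (suc (i + j)) * f)
  collect = solve-∀

Q-overflow : ∀ n i → suc n < i * 2 → Q n i ≡ 0
Q-overflow zero          (suc i)       _                     = refl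
Q-overflow (suc zero)    (suc zero)    (s≤s (s≤s ()))
Q-overflow (suc zero)    (suc (suc i)) _                     = refl
Q-overflow (suc (suc n)) (suc i)       (s≤s (s≤s n+1<2i)) = cong₂ (λ x y → x + 8 * y)
  (Q-overflow (suc n) (suc i) (s≤s (s≤s (ℕ.<⇒≤ n+1<2i)))) (Q-overflow n i n+1<2i)

c-overflow : ∀ n i → suc n < i * 2 → c n (suc i) ≡ 0
c-overflow zero          (suc i)             _               = refl
c-overflow (suc zero)    (suc zero)          (s≤s (s≤s ()))
c-overflow (suc zero)    (suc (suc i))       _               = refl
c-overflow (suc (suc n)) (suc i)             (s≤s (s≤s n+1<2i)) = cong₂ (λ x y → 2 * (4 * x) + 2 * y)
  (c-overflow n i n+1<2i) (c-overflow (suc n) (suc i) (s≤s (s≤s (ℕ.<⇒≤ n+1<2i))))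

-- The recurrence composes n + 1 from i parts of size two, of weight 8 x, and j parts of size one,
-- of weight 1. Extended backwards it gives Q_(-1) = 1/2; the shift to n + 1 and the doubling turn
-- this into T(0,0) = 1.
Q-T : ∀ n i j → suc n ≡ i * 2 + j → 2 * Q n i ≡ 8 ^ i * T i j
Q-T zero          zero          _       refl = refl
Q-T (suc zero)    zero          _       refl = refl
Q-T (suc zero)    (suc zero)    zero    refl = refl
Q-T (suc (suc n)) zero          _       refl = Q-T (suc n) zero (suc (suc n)) refl
Q-T (suc (suc n)) (suc i)       zero    eq   = begin
  2 * (Q (suc n) (suc i) + 8 * Q n i)
    ≡⟨ cong (λ x → 2 * (x + 8 * Q n i)) (Q-overflow (suc n) (suc i) (ℕ.≤-reflexive (trans eq (ℕ.+-identityʳ _)))) ⟩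
  2 * (8 * Q n i)                             ≡⟨ swap-factors (Q n i) ⟩
  8 * (2 * Q n i)
    ≡⟨ cong (8 *_) (Q-T n i 0 (ℕ.suc-injective (ℕ.suc-injective eq))) ⟩
  8 * (8 ^ i * T i 0)                         ≡⟨ cong (λ t → 8 * (8 ^ i * t)) (T-zero i) ⟩
  8 * (8 ^ i * 1)                             ≡⟨ ℕ.*-assoc 8 (8 ^ i) 1 ⟨
  8 ^ suc i * 1                               ∎
  where
  open ≡-Reasoning
  swap-factors : ∀ x → 2 * (8 * x) ≡ 8 * (2 * x)
  swap-factors = solve-∀
Q-T (suc (suc n)) (suc i)       (suc j) eq   = begin
  2 * (Q (suc n) (suc i) + 8 * Q n i)                ≡⟨ expand (Q (suc n) (suc i)) (Q n i) ⟩
  2 * Q (suc n) (suc i) + 8 * (2 * Q n i)            ≡⟨ cong₂ (λ x y → x + 8 * y)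
    (Q-T (suc n) (suc i) j (ℕ.suc-injective (trans eq (ℕ.+-suc (suc i * 2) j))))
    (Q-T n i (suc j) (ℕ.suc-injective (ℕ.suc-injective eq))) ⟩
  8 ^ suc i * T (suc i) j + 8 * (8 ^ i * T i (suc j))    ≡⟨ collect (8 ^ i) (T (suc i) j) (T i (suc j)) ⟩
  8 ^ suc i * T (suc i) (suc j)                       ∎
  where
  open ≡-Reasoning
  expand : ∀ x y → 2 * (x + 8 * y) ≡ 2 * x + 8 * (2 * y)
  expand = solve-∀
  collect : ∀ k s t → 8 * k * s + 8 * (k * t) ≡ 8 * k * (t + s)
  collect = solve-∀

-- As for `Q`, except that parts of size one have weight 2 and that c_(-1) = x/2 shifts the index i
-- by one.
c-T : ∀ n i j → suc n ≡ i * 2 + j → 2 * c n (suc i) ≡ 8 ^ i * (2 ^ j * T i j)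
c-T zero          zero       _       refl = refl
c-T (suc zero)    zero       _       refl = refl
c-T (suc zero)    (suc zero) zero    refl = refl
c-T (suc (suc n)) zero       _       refl = begin
  2 * (2 * (4 * c n 0) + 2 * c (suc n) 1)     ≡⟨ cong (λ x → 2 * (2 * (4 * x) + 2 * c (suc n) 1)) (c-zero n) ⟩
  2 * (2 * c (suc n) 1)                       ≡⟨ cong (2 *_) (c-T (suc n) 0 (2 + n) refl) ⟩
  2 * (1 * (2 ^ (2 + n) * 2))                 ≡⟨ collect (2 ^ (2 + n)) ⟩
  1 * (2 ^ (3 + n) * 2)                       ∎
  where
  open ≡-Reasoning
  collect : ∀ k → 2 * (1 * (k * 2)) ≡ 1 * ((2 * k) * 2)
  collect = solve-∀
c-T (suc (suc n)) (suc i)    zero    eq   = begin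
  2 * (2 * (4 * c n (suc i)) + 2 * c (suc n) (2 + i))
    ≡⟨ cong (λ x → 2 * (2 * (4 * c n (suc i)) + 2 * x)) (c-overflow (suc n) (suc i) (ℕ.≤-reflexive (trans eq (ℕ.+-identityʳ _)))) ⟩
  2 * (2 * (4 * c n (suc i)) + 0)             ≡⟨ swap-factors (c n (suc i)) ⟩
  8 * (2 * c n (suc i))
    ≡⟨ cong (8 *_) (c-T n i 0 (ℕ.suc-injective (ℕ.suc-injective eq))) ⟩
  8 * (8 ^ i * (1 * T i 0))                   ≡⟨ cong (λ t → 8 * (8 ^ i * (1 * t))) (T-zero i) ⟩
  8 * (8 ^ i * 1)                             ≡⟨ ℕ.*-assoc 8 (8 ^ i) 1 ⟨
  8 ^ suc i * 1                               ∎
  where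
  open ≡-Reasoning
  swap-factors : ∀ x → 2 * (2 * (4 * x) + 0) ≡ 8 * (2 * x)
  swap-factors = solve-∀
c-T (suc (suc n)) (suc i)    (suc j) eq   = begin
  2 * (2 * (4 * c n (suc i)) + 2 * c (suc n) (2 + i))    ≡⟨ expand (c n (suc i)) (c (suc n) (2 + i)) ⟩
  8 * (2 * c n (suc i)) + 2 * (2 * c (suc n) (2 + i))    ≡⟨ cong₂ (λ x y → 8 * x + 2 * y)
    (c-T n i (suc j) (ℕ.suc-injective (ℕ.suc-injective eq)))
    (c-T (suc n) (suc i) j (ℕ.suc-injective (trans eq (ℕ.+-suc (suc i * 2) j)))) ⟩
  8 * (8 ^ i * (2 ^ suc j * T i (suc j))) + 2 * (8 ^ suc i * (2 ^ j * T (suc i) j))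
    ≡⟨ collect (8 ^ i) (2 ^ j) (T i (suc j)) (T (suc i) j) ⟩
  8 ^ suc i * (2 ^ suc j * T (suc i) (suc j))  ∎
  where
  open ≡-Reasoning
  expand : ∀ x y → 2 * (2 * (4 * x) + 2 * y) ≡ 8 * (2 * x) + 2 * (2 * y)
  expand = solve-∀
  collect : ∀ k l s t → 8 * (k * (2 * l * s)) + 2 * (8 * k * (l * t)) ≡ 8 * k * (2 * l * (s + t))
  collect = solve-∀

-- T (i + 1) (j - 1), extended by 0 to j = 0.
T⁺ : ℕ → ℕ → ℕ
T⁺ i zero    = 0
T⁺ i (suc j) = T (suc i) j

Q-T⁺ : ∀ n i e → n ≡ i * 2 + e → 2 * Q n (suc i) ≡ 8 ^ i * (8 * T⁺ i e)
Q-T⁺ n i zero    eq = begin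
  2 * Q n (suc i)
    ≡⟨ cong (2 *_) (Q-overflow n (suc i) (s≤s (ℕ.≤-reflexive (cong suc (trans eq (ℕ.+-identityʳ _)))))) ⟩
  0                       ≡⟨ ℕ.*-zeroʳ (8 ^ i) ⟨
  8 ^ i * (8 * 0)         ∎
  where open ≡-Reasoning
Q-T⁺ n i (suc e) eq = begin
  2 * Q n (suc i)              ≡⟨ Q-T n (suc i) e (cong suc (trans eq (ℕ.+-suc (i * 2) e))) ⟩
  8 ^ suc i * T (suc i) e      ≡⟨ rearrange (8 ^ i) (T (suc i) e) ⟩
  8 ^ i * (8 * T (suc i) e)    ∎
  where
  open ≡-Reasoning
  rearrange : ∀ x y → 8 * x * y ≡ x * (8 * y)
  rearrange = solve-∀

a-T : ∀ n i e → n ≡ i * 2 + e →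
      2 * a n (suc i) + 8 ^ i * T i (suc e) ≡ 8 ^ i * (8 * T⁺ i e + 2 ^ suc e * T i (suc e))
a-T n i e eq = begin
  2 * a n (suc i) + 8 ^ i * T i (suc e)      ≡⟨ cong (2 * a n (suc i) +_) (Q-T n i (suc e) eq′) ⟨
  2 * a n (suc i) + 2 * Q n i                ≡⟨ ℕ.*-distribˡ-+ 2 (a n (suc i)) (Q n i) ⟨
  2 * (a n (suc i) + Q n i)                  ≡⟨ cong (2 *_) (a-Q n i) ⟩
  2 * (c n (suc i) + Q n (suc i))            ≡⟨ ℕ.*-distribˡ-+ 2 (c n (suc i)) (Q n (suc i)) ⟩
  2 * c n (suc i) + 2 * Q n (suc i)          ≡⟨ cong₂ _+_ (c-T n i (suc e) eq′) (Q-T⁺ n i e eq) ⟩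
  8 ^ i * (2 ^ suc e * T i (suc e)) + 8 ^ i * (8 * T⁺ i e)
    ≡⟨ collect (8 ^ i) (2 ^ suc e * T i (suc e)) (8 * T⁺ i e) ⟩
  8 ^ i * (8 * T⁺ i e + 2 ^ suc e * T i (suc e)) ∎
  where
  open ≡-Reasoning
  eq′ : suc n ≡ i * 2 + suc e
  eq′ = trans (cong suc eq) (sym (ℕ.+-suc (i * 2) e))
  collect : ∀ x y z → x * y + x * z ≡ x * (z + y)
  collect = solve-∀

-- For n + 1 = 2 i both `c` and x `Q` still have a term of degree i + 1, but these leading terms are
-- equal and cancel in `a`. For larger i they vanish separately.
a-overflow : ∀ n i → suc n ≤ i * 2 → a n (suc i) ≡ 0
a-overflow n i n<2i = ℕ.+-cancelʳ-≡ (Q n i) (a n (suc i)) 0 (begin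
  a n (suc i) + Q n i          ≡⟨ a-Q n i ⟩
  c n (suc i) + Q n (suc i)
    ≡⟨ cong (c n (suc i) +_) (Q-overflow n (suc i) (s≤s (s≤s (ℕ.≤-trans (ℕ.n≤1+n n) n<2i)))) ⟩
  c n (suc i) + 0              ≡⟨ ℕ.+-identityʳ _ ⟩
  c n (suc i)                  ≡⟨ c≡Q (ℕ.m≤n⇒m<n∨m≡n n<2i) ⟩
  Q n i                        ∎)
  where
  open ≡-Reasoning
  c≡Q : suc n < i * 2 ⊎ suc n ≡ i * 2 → c n (suc i) ≡ Q n i
  c≡Q (inj₁ n+1<2i) = trans (c-overflow n i n+1<2i) (sym (Q-overflow n i n+1<2i))
  c≡Q (inj₂ n+1≡2i) = ℕ.*-cancelˡ-≡ (c n (suc i)) (Q n i) 2 (begin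
    2 * c n (suc i)          ≡⟨ c-T n i 0 eq ⟩
    8 ^ i * (1 * T i 0)      ≡⟨ cong (8 ^ i *_) (ℕ.*-identityˡ (T i 0)) ⟩
    8 ^ i * T i 0            ≡⟨ Q-T n i 0 eq ⟨
    2 * Q n i                ∎)
    where
    eq : suc n ≡ i * 2 + 0
    eq = trans n+1≡2i (sym (ℕ.+-identityʳ _))

0<2a : ∀ n i e → n ≡ i * 2 + e → 0 < 2 * a n (suc i)
0<2a n i e eq = ℕ.+-cancelʳ-< (8 ^ i * T i (suc e)) 0 (2 * a n (suc i)) (begin-strict
  8 ^ i * T i (suc e)                              <⟨ ℕ.*-monoʳ-< (8 ^ i) {{ℕ.m^n≢0 8 i}} doubles ⟩
  8 ^ i * (8 * T⁺ i e + 2 ^ suc e * T i (suc e))   ≡⟨ a-T n i e eq ⟨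
  2 * a n (suc i) + 8 ^ i * T i (suc e)            ∎)
  where
  open ℕ.≤-Reasoning
  -- The term moved to the left in `a-T` appears on the right with a coefficient of at least 2.
  doubles : T i (suc e) < 8 * T⁺ i e + 2 ^ suc e * T i (suc e)
  doubles = begin-strict
    T i (suc e)                                <⟨ ℕ.m<m+n (T i (suc e)) (1≤T i (suc e)) ⟩
    T i (suc e) + T i (suc e)                  ≡⟨ cong (T i (suc e) +_) (ℕ.+-identityʳ _) ⟨
    2 * T i (suc e)                            ≤⟨ ℕ.*-monoˡ-≤ (T i (suc e)) (ℕ.*-monoʳ-≤ 2 (ℕ.m^n>0 2 e)) ⟩
    2 ^ suc e * T i (suc e)                    ≤⟨ ℕ.m≤n+m _ (8 * T⁺ i e) ⟩
    8 * T⁺ i e + 2 ^ suc e * T i (suc e)       ∎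

-- Comparison of consecutive coefficients

-- T⁺ (k + 1) e, T (k + 1) (e + 1) and T k (e + 3), divided by (k + e)! and
-- multiplied by (k + 2)! (e + 3)!.
X Y Z : ℕ → ℕ → ℕ
X k e = (k + 2 * e) * ((e + 3) * (e + 2) * (e + 1) * e)
Y k e = (k + 2 * e + 3) * (e + 3) * (e + 2) * ((k + e + 1) * (k + 2))
Z k e = (k + 2 * e + 6) * (k + e + 2) * (k + 1) * ((k + e + 1) * (k + 2))

-- With P = 2 ^ (e + 3), these compare the coefficients at k + 1 and k + 2 for
-- n = 2 (k + 1) + e.
Falls Rises : ℕ → ℕ → ℕ → Set
Falls k e P = 64 * X k e + Z k e + P * (2 * Y k e) < P * Z k e + 16 * Y k e
Rises k e P = 16 * Y k e + P * Z k e < P * (2 * Y k e) + (64 * X k e + Z k e)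

X-T : ∀ k e → (2 + k) ! * (3 + e) ! * T⁺ (suc k) e ≡ (k + e) ! * X k e
X-T k zero = trans (ℕ.*-zeroʳ ((2 + k) ! * 6)) (annihilate k ((k + 0) !))
  where
  annihilate : ∀ k f → 0 ≡ f * ((k + 0) * ((0 + 3) * (0 + 2) * (0 + 1) * 0))
  annihilate = solve-∀
-- Here T(k+2, 0) = 1 is evaluated directly, since `T-!` starts at second argument 1.
X-T k (suc zero) = begin
  (2 + k) ! * 24 * 1                                     ≡⟨ expand k (k !) ⟩
  (suc k) ! * (2 + k) * 24                               ≡⟨ cong (λ l → l ! * (2 + k) * 24) (ℕ.+-comm 1 k) ⟩
  (k + 1) ! * (2 + k) * 24                               ≡⟨ collect k ((k + 1) !) ⟩
  (k + 1) ! * X k 1                                      ∎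
  where
  open ≡-Reasoning
  expand : ∀ k f → (2 + k) * ((1 + k) * f) * 24 * 1 ≡ (1 + k) * f * (2 + k) * 24
  expand = solve-∀
  collect : ∀ k f → f * (2 + k) * 24 ≡ f * ((k + 2 * 1) * ((1 + 3) * (1 + 2) * (1 + 1) * 1))
  collect = solve-∀
X-T k (suc (suc e)) = begin
  (2 + k) ! * (5 + e) ! * T (2 + k) (suc e)
    ≡⟨ expand e (T (2 + k) (suc e)) ((2 + k) !) (suc e !) ⟩
  T (2 + k) (suc e) * ((2 + k) ! * suc e !) * ((5 + e) * (4 + e) * (3 + e) * (2 + e))
    ≡⟨ cong (_* ((5 + e) * (4 + e) * (3 + e) * (2 + e))) (T-! (2 + k) e) ⟩
  (2 + k + 2 * suc e) * (2 + k + e) ! * ((5 + e) * (4 + e) * (3 + e) * (2 + e))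
    ≡⟨ cong (λ l → (2 + k + 2 * suc e) * l ! * ((5 + e) * (4 + e) * (3 + e) * (2 + e))) (reindex k e) ⟩
  (2 + k + 2 * suc e) * (k + (2 + e)) ! * ((5 + e) * (4 + e) * (3 + e) * (2 + e))
    ≡⟨ collect k e ((k + (2 + e)) !) ⟩
  (k + (2 + e)) ! * X k (2 + e)
    ∎
  where
  open ≡-Reasoning
  reindex : ∀ k e → 2 + k + e ≡ k + (2 + e)
  reindex = solve-∀
  expand : ∀ e t f g → f * ((5 + e) * ((4 + e) * ((3 + e) * ((2 + e) * g)))) * t ≡
           t * (f * g) * ((5 + e) * (4 + e) * (3 + e) * (2 + e))
  expand = solve-∀
  collect : ∀ k e f → (2 + k + 2 * suc e) * f * ((5 + e) * (4 + e) * (3 + e) * (2 + e)) ≡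
    f * ((k + 2 * (2 + e)) * ((2 + e + 3) * (2 + e + 2) * (2 + e + 1) * (2 + e)))
  collect = solve-∀

Y-T : ∀ k e → (2 + k) ! * (3 + e) ! * T (suc k) (suc e) ≡ (k + e) ! * Y k e
Y-T k e = begin
  (2 + k) ! * (3 + e) ! * T (suc k) (suc e)
    ≡⟨ expand k e (T (suc k) (suc e)) (suc k !) (suc e !) ⟩
  T (suc k) (suc e) * (suc k ! * suc e !) * ((2 + k) * (3 + e) * (2 + e))
    ≡⟨ cong (_* ((2 + k) * (3 + e) * (2 + e))) (T-! (suc k) e) ⟩
  (suc k + 2 * suc e) * (suc (k + e) * (k + e) !) * ((2 + k) * (3 + e) * (2 + e))
    ≡⟨ collect k e ((k + e) !) ⟩
  (k + e) ! * Y k e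
    ∎
  where
  open ≡-Reasoning
  expand : ∀ k e t f g → (2 + k) * f * ((3 + e) * ((2 + e) * g)) * t ≡
           t * (f * g) * ((2 + k) * (3 + e) * (2 + e))
  expand = solve-∀
  collect : ∀ k e f → (suc k + 2 * suc e) * (suc (k + e) * f) * ((2 + k) * (3 + e) * (2 + e)) ≡
    f * ((k + 2 * e + 3) * (e + 3) * (e + 2) * ((k + e + 1) * (k + 2)))
  collect = solve-∀

Z-T : ∀ k e → (2 + k) ! * (3 + e) ! * T k (3 + e) ≡ (k + e) ! * Z k e
Z-T k e = begin
  (2 + k) ! * (3 + e) ! * T k (3 + e)
    ≡⟨ expand k (T k (3 + e)) (k !) ((3 + e) !) ⟩
  T k (3 + e) * (k ! * (3 + e) !) * ((2 + k) * (1 + k))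
    ≡⟨ cong (_* ((2 + k) * (1 + k))) (T-! k (2 + e)) ⟩
  (k + 2 * (3 + e)) * (k + (2 + e)) ! * ((2 + k) * (1 + k))
    ≡⟨ cong (λ l → (k + 2 * (3 + e)) * l ! * ((2 + k) * (1 + k))) (reindex k e) ⟩
  (k + 2 * (3 + e)) * ((2 + (k + e)) * (suc (k + e) * (k + e) !)) * ((2 + k) * (1 + k))
    ≡⟨ collect k e ((k + e) !) ⟩
  (k + e) ! * Z k e
    ∎
  where
  open ≡-Reasoning
  reindex : ∀ k e → k + (2 + e) ≡ 2 + (k + e)
  reindex = solve-∀
  expand : ∀ k t f g → (2 + k) * ((1 + k) * f) * g * t ≡ t * (f * g) * ((2 + k) * (1 + k))
  expand = solve-∀
  collect : ∀ k e f → (k + 2 * (3 + e)) * ((2 + (k + e)) * (suc (k + e) * f)) * ((2 + k) * (1 + k)) ≡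
    f * ((k + 2 * e + 6) * (k + e + 2) * (k + 1) * ((k + e + 1) * (k + 2)))
  collect = solve-∀

module _ (k e : ℕ) where

  private
    n = suc k * 2 + e
    K = 8 ^ k
    P = 2 ^ (3 + e)
    M = (2 + k) ! * (3 + e) !
    F = (k + e) !
    t₀ = T k (3 + e)
    t₁ = T (suc k) (suc e)
    t₂ = T⁺ (suc k) e
    -- Each of the two coefficients comes from `a-T` with its own subtracted term. `S` is the sum of
    -- these terms, so adding it to both coefficients permits a comparison in the natural numbers.
    S  = 8 * K * t₁ + K * t₀
    L R : ℕ → ℕ → ℕ → ℕ
    L x y z = 64 * x + z + P * (2 * y)
    R x y z = P * z + 16 * y
    instance
      M≢0 : NonZero M
      M≢0 = ℕ._!*_!≢0 (2 + k) (3 + e)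
      F≢0 : NonZero F
      F≢0 = ℕ._!≢0 (k + e)
      K≢0 : NonZero K
      K≢0 = ℕ.m^n≢0 8 k

  near : 2 * a n (suc k) + S ≡ K * R t₂ t₁ t₀
  near = begin
    2 * a n (suc k) + (8 * K * t₁ + K * t₀)    ≡⟨ rearrange (2 * a n (suc k)) (8 * K * t₁) (K * t₀) ⟩
    2 * a n (suc k) + K * t₀ + 8 * K * t₁      ≡⟨ cong (_+ 8 * K * t₁) (a-T n k (2 + e) (reindex k e)) ⟩
    K * (8 * t₁ + P * t₀) + 8 * K * t₁         ≡⟨ collect K P t₀ t₁ ⟩
    K * (P * t₀ + 16 * t₁)                     ∎
    where
    open ≡-Reasoning
    reindex : ∀ k e → suc k * 2 + e ≡ k * 2 + (2 + e)
    reindex = solve-∀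
    rearrange : ∀ x y z → x + (y + z) ≡ x + z + y
    rearrange = solve-∀
    collect : ∀ K P x y → K * (8 * y + P * x) + 8 * K * y ≡ K * (P * x + 16 * y)
    collect = solve-∀

  beyond : 2 * a n (2 + k) + S ≡ K * L t₂ t₁ t₀
  beyond = begin
    2 * a n (2 + k) + (8 * K * t₁ + K * t₀)        ≡⟨ ℕ.+-assoc (2 * a n (2 + k)) (8 * K * t₁) (K * t₀) ⟨
    2 * a n (2 + k) + 8 * K * t₁ + K * t₀          ≡⟨ cong (_+ K * t₀) (a-T n (suc k) e refl) ⟩
    8 * K * (8 * t₂ + 2 ^ suc e * t₁) + K * t₀     ≡⟨ collect K (2 ^ e) t₀ t₁ t₂ ⟩
    K * (64 * t₂ + t₀ + P * (2 * t₁))              ∎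
    where
    open ≡-Reasoning
    collect : ∀ K p x y z → 8 * K * (8 * z + 2 * p * y) + K * x ≡
              K * (64 * z + x + 2 * (2 * (2 * p)) * (2 * y))
    collect = solve-∀

  scale-L : M * L t₂ t₁ t₀ ≡ F * L (X k e) (Y k e) (Z k e)
  scale-L = begin
    M * (64 * t₂ + t₀ + P * (2 * t₁))                     ≡⟨ distribute M P t₂ t₁ t₀ ⟩
    64 * (M * t₂) + M * t₀ + P * (2 * (M * t₁))
      ≡⟨ cong₂ _+_ (cong₂ (λ x z → 64 * x + z) (X-T k e) (Z-T k e)) (cong (λ y → P * (2 * y)) (Y-T k e)) ⟩
    64 * (F * X k e) + F * Z k e + P * (2 * (F * Y k e))  ≡⟨ distribute F P (X k e) (Y k e) (Z k e) ⟨
    F * (64 * X k e + Z k e + P * (2 * Y k e))            ∎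
    where
    open ≡-Reasoning
    distribute : ∀ M P x y z → M * (64 * x + z + P * (2 * y)) ≡ 64 * (M * x) + M * z + P * (2 * (M * y))
    distribute = solve-∀

  scale-R : M * R t₂ t₁ t₀ ≡ F * R (X k e) (Y k e) (Z k e)
  scale-R = begin
    M * (P * t₀ + 16 * t₁)                    ≡⟨ distribute M P t₁ t₀ ⟩
    P * (M * t₀) + 16 * (M * t₁)              ≡⟨ cong₂ (λ z y → P * z + 16 * y) (Z-T k e) (Y-T k e) ⟩
    P * (F * Z k e) + 16 * (F * Y k e)        ≡⟨ distribute F P (Y k e) (Z k e) ⟨
    F * (P * Z k e + 16 * Y k e)              ∎
    where
    open ≡-Reasoning
    distribute : ∀ M P y z → M * (P * z + 16 * y) ≡ P * (M * z) + 16 * (M * y)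
    distribute = solve-∀

  fall-if : Falls k e P → 2 * a n (2 + k) < 2 * a n (suc k)
  fall-if lt = ℕ.+-cancelʳ-< S _ _ (subst₂ _<_ (sym beyond) (sym near) (ℕ.*-monoʳ-< K
    (ℕ.*-cancelˡ-< M _ _ (subst₂ _<_ (sym scale-L) (sym scale-R) (ℕ.*-monoʳ-< F lt)))))

  rise-if : Rises k e P → 2 * a n (suc k) < 2 * a n (2 + k)
  rise-if lt = ℕ.+-cancelʳ-< S _ _ (subst₂ _<_ (sym near) (sym beyond) (ℕ.*-monoʳ-< K
    (ℕ.*-cancelˡ-< M _ _ (subst₂ _<_ (sym scale-R) (sym scale-L) (ℕ.*-monoʳ-< F
      (subst₂ _<_ (ℕ.+-comm (16 * Y k e) (P * Z k e)) (ℕ.+-comm (P * (2 * Y k e)) (64 * X k e + Z k e)) lt))))))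

-- In `Falls` on the line k = e + 2 the terms in e^5 cancel exactly when P is replaced by a bound of
-- slope 9; a smaller slope would leave a negative leading term. The constant 7 makes the bound an
-- equality at e = 1. The induction starts at 1 because doubling the value 7 at e = 0 gives only 14
-- < 16.
9e+7≤2^ : ∀ e → 9 * e + 7 ≤ 2 ^ (3 + e)
9e+7≤2^ 0             = ℕ.n≤1+n 7
9e+7≤2^ 1             = ℕ.≤-refl
9e+7≤2^ (suc (suc e)) = begin
  9 * (2 + e) + 7                    ≤⟨ ℕ.m≤m+n _ (9 * e + 7) ⟩
  9 * (2 + e) + 7 + (9 * e + 7)      ≡⟨ arithmetic e ⟩
  2 * (9 * suc e + 7)                ≤⟨ ℕ.*-monoʳ-≤ 2 (9e+7≤2^ (suc e)) ⟩
  2 * 2 ^ (4 + e)                    ∎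
  where
  open ℕ.≤-Reasoning
  arithmetic : ∀ e → 9 * (2 + e) + 7 + (9 * e + 7) ≡ 2 * (9 * suc e + 7)
  arithmetic = solve-∀

-- If A ≥ B, then P A - P B is increasing in P.
dominate : ∀ {p P A B d x y g} → p ≤ P → A ≡ B + d → p * A + x ≡ y + p * B + suc g →
           y + P * B < P * A + x
dominate {p} {P} {A} {B} {d} {x} {y} {g} p≤P A≡B+d at-p with r , refl ← ℕ.m≤n⇒∃[o]m+o≡n p≤P = begin-strict
  y + (p + r) * B                          <⟨ ℕ.m<m+n (y + (p + r) * B) {suc (g + r * d)} (s≤s z≤n) ⟩
  y + (p + r) * B + suc (g + r * d)        ≡⟨ rearrange p r B d y g ⟩
  y + p * B + suc g + r * (B + d)          ≡⟨ cong₂ (λ k l → k + r * l) at-p A≡B+d ⟨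
  p * A + x + r * A                        ≡⟨ collect p r A x ⟩
  (p + r) * A + x                          ∎
  where
  open ℕ.≤-Reasoning
  rearrange : ∀ p r B d y g → y + (p + r) * B + suc (g + r * d) ≡ y + p * B + suc g + r * (B + d)
  rearrange = solve-∀
  collect : ∀ p r A x → p * A + x + r * A ≡ (p + r) * A + x
  collect = solve-∀

-- In each case the difference of the two sides of Falls or Rises, with
-- P = 9 e + 7, is a polynomial with nonnegative coefficients.
private module Certificates where

  fall-difference : ∀ e t →
    ((2 + e + t) + 2 * e + 6) * ((2 + e + t) + e + 2) * ((2 + e + t) + 1) * (((2 + e + t) + e + 1) * ((2 + e + t) + 2)) ≡
    2 * (((2 + e + t) + 2 * e + 3) * (e + 3) * (e + 2) * (((2 + e + t) + e + 1) * ((2 + e + t) + 2))) +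
    ((2 + e + t) + e + 1) * ((2 + e + t) + 2) *
     (9 * e * e * t + 6 * e * e + 6 * e * t * t + 45 * e * t + 30 * e + t * t * t + 15 * t * t +
      56 * t + 36)
  fall-difference = solve-∀

  fall-certificate : ∀ e t →
    (9 * e + 7) * (((2 + e + t) + 2 * e + 6) * ((2 + e + t) + e + 2) * ((2 + e + t) + 1) * (((2 + e + t) + e + 1) * ((2 + e + t) + 2))) +
    16 * (((2 + e + t) + 2 * e + 3) * (e + 3) * (e + 2) * (((2 + e + t) + e + 1) * ((2 + e + t) + 2))) ≡
    64 * (((2 + e + t) + 2 * e) * ((e + 3) * (e + 2) * (e + 1) * e)) +
    ((2 + e + t) + 2 * e + 6) * ((2 + e + t) + e + 2) * ((2 + e + t) + 1) * (((2 + e + t) + e + 1) * ((2 + e + t) + 2)) +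
    (9 * e + 7) * (2 * (((2 + e + t) + 2 * e + 3) * (e + 3) * (e + 2) * (((2 + e + t) + e + 1) * ((2 + e + t) + 2)))) +
    suc (162 * e * e * e * e * e * t + 351 * e * e * e * e * t * t + 2061 * e * e * e * e * t +
         948 * e * e * e * e + 261 * e * e * e * t * t * t + 3018 * e * e * e * t * t +
         9909 * e * e * e * t + 6930 * e * e * e + 81 * e * e * t * t * t * t +
         1475 * e * e * t * t * t + 9138 * e * e * t * t + 22516 * e * e * t + 17910 * e * e +
         9 * e * t * t * t * t * t + 252 * e * t * t * t * t + 2485 * e * t * t * t +
         11316 * e * t * t + 24014 * e * t + 19500 * e + 6 * t * t * t * t * t +
         132 * t * t * t * t + 1122 * t * t * t + 4656 * t * t + 9492 * t + 7631)
  fall-certificate = solve-∀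

  rise-difference : ∀ b s →
    2 * (((4 + b) + 2 * (3 + b + s) + 3) * ((3 + b + s) + 3) * ((3 + b + s) + 2) * (((4 + b) + (3 + b + s) + 1) * ((4 + b) + 2))) ≡
    ((4 + b) + 2 * (3 + b + s) + 6) * ((4 + b) + (3 + b + s) + 2) * ((4 + b) + 1) * (((4 + b) + (3 + b + s) + 1) * ((4 + b) + 2)) +
    ((4 + b) + (3 + b + s) + 1) * ((4 + b) + 2) *
     (9 * b * b * s + 3 * b * b + 12 * b * s * s + 93 * b * s + 27 * b + 4 * s * s * s +
      60 * s * s + 236 * s + 60)
  rise-difference = solve-∀

  rise-certificate : ∀ b s →
    (9 * (3 + b + s) + 7) * (2 * (((4 + b) + 2 * (3 + b + s) + 3) * ((3 + b + s) + 3) * ((3 + b + s) + 2) * (((4 + b) + (3 + b + s) + 1) * ((4 + b) + 2)))) +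
    (64 * (((4 + b) + 2 * (3 + b + s)) * (((3 + b + s) + 3) * ((3 + b + s) + 2) * ((3 + b + s) + 1) * (3 + b + s))) +
    ((4 + b) + 2 * (3 + b + s) + 6) * ((4 + b) + (3 + b + s) + 2) * ((4 + b) + 1) * (((4 + b) + (3 + b + s) + 1) * ((4 + b) + 2))) ≡
    16 * (((4 + b) + 2 * (3 + b + s) + 3) * ((3 + b + s) + 3) * ((3 + b + s) + 2) * (((4 + b) + (3 + b + s) + 1) * ((4 + b) + 2))) +
    (9 * (3 + b + s) + 7) * (((4 + b) + 2 * (3 + b + s) + 6) * ((4 + b) + (3 + b + s) + 2) * ((4 + b) + 1) * (((4 + b) + (3 + b + s) + 1) * ((4 + b) + 2))) +
    suc (162 * b * b * b * b * b * s + 162 * b * b * b * b * b + 459 * b * b * b * b * s * s +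
         4599 * b * b * b * b * s + 3192 * b * b * b * b + 477 * b * b * b * s * s * s +
         10329 * b * b * b * s * s + 48312 * b * b * b * s + 23946 * b * b * b +
         216 * b * b * s * s * s * s + 8513 * b * b * s * s * s + 81516 * b * b * s * s +
         239209 * b * b * s + 83748 * b * b + 36 * b * s * s * s * s * s +
         2932 * b * s * s * s * s + 46384 * b * s * s * s + 271850 * b * s * s + 563510 * b * s +
         130512 * b + 344 * s * s * s * s * s + 8536 * s * s * s * s + 79348 * s * s * s +
         326324 * s * s + 507408 * s + 63359)
  rise-certificate = solve-∀

  rise0-difference : ∀ s →
    2 * ((0 + 2 * (1 + s) + 3) * ((1 + s) + 3) * ((1 + s) + 2) * ((0 + (1 + s) + 1) * (0 + 2))) ≡
    (0 + 2 * (1 + s) + 6) * (0 + (1 + s) + 2) * (0 + 1) * ((0 + (1 + s) + 1) * (0 + 2)) +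
    (0 + (1 + s) + 1) * (0 + 2) *
     (4 * s * s * s + 36 * s * s + 104 * s + 96)
  rise0-difference = solve-∀

  rise0-certificate : ∀ s →
    (9 * (1 + s) + 7) * (2 * ((0 + 2 * (1 + s) + 3) * ((1 + s) + 3) * ((1 + s) + 2) * ((0 + (1 + s) + 1) * (0 + 2)))) +
    (64 * ((0 + 2 * (1 + s)) * (((1 + s) + 3) * ((1 + s) + 2) * ((1 + s) + 1) * (1 + s))) +
    (0 + 2 * (1 + s) + 6) * (0 + (1 + s) + 2) * (0 + 1) * ((0 + (1 + s) + 1) * (0 + 2))) ≡
    16 * ((0 + 2 * (1 + s) + 3) * ((1 + s) + 3) * ((1 + s) + 2) * ((0 + (1 + s) + 1) * (0 + 2))) +
    (9 * (1 + s) + 7) * ((0 + 2 * (1 + s) + 6) * (0 + (1 + s) + 2) * (0 + 1) * ((0 + (1 + s) + 1) * (0 + 2))) +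
    suc (200 * s * s * s * s * s + 2264 * s * s * s * s + 9604 * s * s * s + 18916 * s * s +
         17064 * s + 5471)
  rise0-certificate = solve-∀

  rise1-difference : ∀ s →
    2 * ((1 + 2 * (1 + s) + 3) * ((1 + s) + 3) * ((1 + s) + 2) * ((1 + (1 + s) + 1) * (1 + 2))) ≡
    (1 + 2 * (1 + s) + 6) * (1 + (1 + s) + 2) * (1 + 1) * ((1 + (1 + s) + 1) * (1 + 2)) +
    (1 + (1 + s) + 1) * (1 + 2) *
     (4 * s * s * s + 36 * s * s + 98 * s + 72)
  rise1-difference = solve-∀

  rise1-certificate : ∀ s →
    (9 * (1 + s) + 7) * (2 * ((1 + 2 * (1 + s) + 3) * ((1 + s) + 3) * ((1 + s) + 2) * ((1 + (1 + s) + 1) * (1 + 2)))) +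
    (64 * ((1 + 2 * (1 + s)) * (((1 + s) + 3) * ((1 + s) + 2) * ((1 + s) + 1) * (1 + s))) +
    (1 + 2 * (1 + s) + 6) * (1 + (1 + s) + 2) * (1 + 1) * ((1 + (1 + s) + 1) * (1 + 2))) ≡
    16 * ((1 + 2 * (1 + s) + 3) * ((1 + s) + 3) * ((1 + s) + 2) * ((1 + (1 + s) + 1) * (1 + 2))) +
    (9 * (1 + s) + 7) * ((1 + 2 * (1 + s) + 6) * (1 + (1 + s) + 2) * (1 + 1) * ((1 + (1 + s) + 1) * (1 + 2))) +
    suc (236 * s * s * s * s * s + 2864 * s * s * s * s + 13030 * s * s * s + 26980 * s * s +
         23634 * s + 5255)
  rise1-certificate = solve-∀

  rise2-difference : ∀ s →
    2 * ((2 + 2 * (2 + s) + 3) * ((2 + s) + 3) * ((2 + s) + 2) * ((2 + (2 + s) + 1) * (2 + 2))) ≡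
    (2 + 2 * (2 + s) + 6) * (2 + (2 + s) + 2) * (2 + 1) * ((2 + (2 + s) + 1) * (2 + 2)) +
    (2 + (2 + s) + 1) * (2 + 2) *
     (4 * s * s * s + 48 * s * s + 170 * s + 144)
  rise2-difference = solve-∀

  rise2-certificate : ∀ s →
    (9 * (2 + s) + 7) * (2 * ((2 + 2 * (2 + s) + 3) * ((2 + s) + 3) * ((2 + s) + 2) * ((2 + (2 + s) + 1) * (2 + 2)))) +
    (64 * ((2 + 2 * (2 + s)) * (((2 + s) + 3) * ((2 + s) + 2) * ((2 + s) + 1) * (2 + s))) +
    (2 + 2 * (2 + s) + 6) * (2 + (2 + s) + 2) * (2 + 1) * ((2 + (2 + s) + 1) * (2 + 2))) ≡
    16 * ((2 + 2 * (2 + s) + 3) * ((2 + s) + 3) * ((2 + s) + 2) * ((2 + (2 + s) + 1) * (2 + 2))) +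
    (9 * (2 + s) + 7) * ((2 + 2 * (2 + s) + 6) * (2 + (2 + s) + 2) * (2 + 1) * ((2 + (2 + s) + 1) * (2 + 2))) +
    suc (272 * s * s * s * s * s + 4896 * s * s * s * s + 33680 * s * s * s + 107784 * s * s +
         151880 * s + 64799)
  rise2-certificate = solve-∀

  rise3-difference : ∀ s →
    2 * ((3 + 2 * (3 + s) + 3) * ((3 + s) + 3) * ((3 + s) + 2) * ((3 + (3 + s) + 1) * (3 + 2))) ≡
    (3 + 2 * (3 + s) + 6) * (3 + (3 + s) + 2) * (3 + 1) * ((3 + (3 + s) + 1) * (3 + 2)) +
    (3 + (3 + s) + 1) * (3 + 2) *
     (4 * s * s * s + 60 * s * s + 260 * s + 240)
  rise3-difference = solve-∀

  rise3-certificate : ∀ s →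
    (9 * (3 + s) + 7) * (2 * ((3 + 2 * (3 + s) + 3) * ((3 + s) + 3) * ((3 + s) + 2) * ((3 + (3 + s) + 1) * (3 + 2)))) +
    (64 * ((3 + 2 * (3 + s)) * (((3 + s) + 3) * ((3 + s) + 2) * ((3 + s) + 1) * (3 + s))) +
    (3 + 2 * (3 + s) + 6) * (3 + (3 + s) + 2) * (3 + 1) * ((3 + (3 + s) + 1) * (3 + 2))) ≡
    16 * ((3 + 2 * (3 + s) + 3) * ((3 + s) + 3) * ((3 + s) + 2) * ((3 + (3 + s) + 1) * (3 + 2))) +
    (9 * (3 + s) + 7) * ((3 + 2 * (3 + s) + 6) * (3 + (3 + s) + 2) * (3 + 1) * ((3 + (3 + s) + 1) * (3 + 2))) +
    suc (308 * s * s * s * s * s + 7360 * s * s * s * s + 67360 * s * s * s + 287120 * s * s +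
         539292 * s + 308159)
  rise3-certificate = solve-∀

open Certificates

falls : ∀ e t → Falls (2 + e + t) e (2 ^ (3 + e))
falls e t = dominate (9e+7≤2^ e) (fall-difference e t) (fall-certificate e t)

-- The variable `s` measures the distance from the line k = e + 1. On that line the inequality is
-- false at (1, 0) and (2, 1), that is, at n = 4 and n = 7, so k ≤ 3 is treated separately, starting
-- beyond these points.
rises : ∀ k e → k ≤ suc e → 6 ≤ k * 2 + e → Rises k e (2 ^ (3 + e))
rises 0 (suc e) _ _ = dominate (9e+7≤2^ (1 + e)) (rise0-difference e) (rise0-certificate e)
rises 0 0 _ ()
rises 1 (suc e) _ _ = dominate (9e+7≤2^ (1 + e)) (rise1-difference e) (rise1-certificate e)
rises 1 0 _ (s≤s (s≤s ()))
rises 2 (suc (suc e)) _ _ = dominate (9e+7≤2^ (2 + e)) (rise2-difference e) (rise2-certificate e)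
rises 2 1 _ (s≤s (s≤s (s≤s (s≤s (s≤s ())))))
rises 2 0 (s≤s ()) _
rises 3 (suc (suc (suc e))) _ _ = dominate (9e+7≤2^ (3 + e)) (rise3-difference e) (rise3-certificate e)
-- The difference of the two sides is 1080 P - 31320: negative at the linear bound 25, positive at P
-- = 32.
rises 3 2 _ _ = ℕ.<ᵇ⇒< _ _ _
rises 3 1 (s≤s (s≤s ())) _
rises 3 0 (s≤s ()) _
rises (suc (suc (suc (suc b)))) e (s≤s 3+b≤e) _ with s , refl ← ℕ.m≤n⇒∃[o]m+o≡n 3+b≤e =
  dominate (9e+7≤2^ (3 + b + s)) (rise-difference b s) (rise-certificate b s)

-- Position of the peak

-- Strict monotonicity on both sides with bounded quantifiers: it implies `IsPeak` and can be
-- decided by evaluation for small n.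
StrictPeak : (ℕ → ℕ) → ℕ → ℕ → Set
StrictPeak f p q = p ≤ q × (∀ {i} → i < p → f i < f (suc i)) ×
                   (∀ {i} → i < q → p ≤ i → f (suc i) < f i)

strictPeak? : ∀ f p q → Dec (StrictPeak f p q)
strictPeak? f p q = p ℕ.≤? q ×-dec ℕ.allUpTo? (λ i → f i ℕ.<? f (suc i)) p ×-dec
  ℕ.allUpTo? (λ i → p ℕ.≤? i →-dec f (suc i) ℕ.<? f i) q

strictPeak⇒isPeak : ∀ {f p q} → StrictPeak f p q → IsPeak f 0 q p
strictPeak⇒isPeak (p≤q , rise , fall) = record
  { q≤l        = z≤n
  ; l≤m        = ℕ.≤-refl
  ; m≤n        = p≤q
  ; ascending  = λ i _ 1+i<p → ℕ.<⇒≤ (rise (ℕ.<-trans (ℕ.n<1+n i) 1+i<p))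
  ; rise       = λ { i _ refl → rise (ℕ.n<1+n i) }
  ; plateau    = λ i p≤i i≤p → cong _ (ℕ.≤-antisym i≤p p≤i)
  ; fall       = λ p<q → fall p<q ℕ.≤-refl
  ; descending = λ i p<i i<q → ℕ.<⇒≤ (fall i<q (ℕ.<⇒≤ p<i))
  }

strictPeak-cong : ∀ {f g p q} → (∀ i → f i ≡ g i) → StrictPeak f p q → StrictPeak g p q
strictPeak-cong f≗g (p≤q , rise , fall) = p≤q ,
  (λ {i} i<p → subst₂ _<_ (f≗g i) (f≗g (suc i)) (rise i<p)) ,
  (λ {i} i<q p≤i → subst₂ _<_ (f≗g (suc i)) (f≗g i) (fall i<q p≤i))

n≡[n/2]*2+n%2 : ∀ n → n ≡ n / 2 * 2 + n % 2
n≡[n/2]*2+n%2 n = trans (m≡m%n+[m/n]*n n 2) (ℕ.+-comm (n % 2) (n / 2 * 2))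

0<2a-zero : ∀ n → 0 < 2 * a n 0
0<2a-zero n rewrite a-Q-zero n | Q-zero n = s≤s z≤n

0<2a-maximum : ∀ n → 0 < 2 * a n (suc (n / 2))
0<2a-maximum n = 0<2a n (n / 2) (n % 2) (n≡[n/2]*2+n%2 n)

0<2a⇒≤ : ∀ n i → 0 < 2 * a n i → i ≤ suc (n / 2)
0<2a⇒≤ n zero    _    = z≤n
0<2a⇒≤ n (suc i) 0<2a = s≤s (ℕ.≮⇒≥ λ n/2<i → ℕ.<⇒≢ 0<2a (cong (2 *_) (sym (a-overflow n i (begin-strict
  n                        ≡⟨ m≡m%n+[m/n]*n n 2 ⟩
  n % 2 + n / 2 * 2        <⟨ ℕ.+-monoˡ-< (n / 2 * 2) (m%n<n n 2) ⟩
  suc (n / 2) * 2          ≤⟨ ℕ.*-monoˡ-≤ 2 n/2<i ⟩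
  i * 2                    ∎)))))
  where open ℕ.≤-Reasoning

module _ (n : ℕ) (8≤n : 8 ≤ n) where

  private
    q = (n + 2) / 3

    q*2≤n : q * 2 ≤ n
    q*2≤n = ℕ.*-cancelʳ-≤ (q * 2) n 3 (begin
      q * 2 * 3        ≡⟨ commute q ⟩
      q * 3 * 2        ≤⟨ ℕ.*-monoˡ-≤ 2 (m/n*n≤m (n + 2) 3) ⟩
      (n + 2) * 2      ≡⟨ expand n ⟩
      4 + n * 2        ≤⟨ ℕ.+-monoˡ-≤ (n * 2) (ℕ.≤-trans (ℕ.m≤m+n 4 4) 8≤n) ⟩
      n + n * 2        ≡⟨ collect n ⟩
      n * 3            ∎)
      where
      open ℕ.≤-Reasoning
      commute : ∀ q → q * 2 * 3 ≡ q * 3 * 2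
      commute = solve-∀
      expand : ∀ n → (n + 2) * 2 ≡ 4 + n * 2
      expand = solve-∀
      collect : ∀ n → n + n * 2 ≡ n * 3
      collect = solve-∀

    split : ∀ k e → suc k * 2 + e + 2 ≡ suc k * 2 + (2 + e)
    split = solve-∀

    triple : ∀ k → suc k * 3 ≡ suc k * 2 + suc k
    triple = solve-∀

    -- `Rises` starts with genera 1 and 2. Between genera 0 and 1 the power of two in `a-T` decides.
    first-rise : 2 * a n 0 < 2 * a n 1
    first-rise rewrite a-Q-zero n | Q-zero n = ℕ.+-cancelʳ-< 2 2 (2 * a n 1) (begin-strict
      2 + 2                                         <⟨ ℕ.m≤m+n 5 3 ⟩
      8                                             ≡⟨⟩
      2 ^ 2 * 2
        ≤⟨ ℕ.*-monoˡ-≤ 2 (ℕ.^-monoʳ-≤ 2 (ℕ.≤-trans (ℕ.m≤m+n 2 7) (s≤s 8≤n))) ⟩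
      2 ^ suc n * 2                                 ≤⟨ ℕ.m≤n+m _ (8 * T⁺ 0 n) ⟩
      8 * T⁺ 0 n + 2 ^ suc n * 2                    ≡⟨ ℕ.*-identityˡ _ ⟨
      1 * (8 * T⁺ 0 n + 2 ^ suc n * 2)              ≡⟨ a-T n 0 n refl ⟨
      2 * a n 1 + 2                                 ∎)
      where open ℕ.≤-Reasoning

    -- With n = 2 (k + 1) + e, the condition 3 (k + 1) ≤ n + 2 says k ≤ e + 1. Rounding down in `q`
    -- loses nothing, so `after-peak` is the exact complement.
    before-peak : ∀ {k e} → suc k * 2 + e ≡ n → suc k ≤ q → k ≤ suc e
    before-peak {k} {e} eq k<q = s≤s⁻¹ (ℕ.+-cancelˡ-≤ (suc k * 2) (suc k) (2 + e) (begin
      suc k * 2 + suc k          ≡⟨ triple k ⟨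
      suc k * 3                  ≤⟨ ℕ.*-monoˡ-≤ 3 k<q ⟩
      q * 3                      ≤⟨ m/n*n≤m (n + 2) 3 ⟩
      n + 2                      ≡⟨ cong (_+ 2) eq ⟨
      suc k * 2 + e + 2          ≡⟨ split k e ⟩
      suc k * 2 + (2 + e)        ∎))
      where open ℕ.≤-Reasoning

    after-peak : ∀ {k e} → suc k * 2 + e ≡ n → q ≤ k → 2 + e ≤ k
    after-peak {k} {e} eq q≤k = s≤s⁻¹ (ℕ.+-cancelˡ-< (suc k * 2) (2 + e) (suc k) (begin-strict
      suc k * 2 + (2 + e)             ≡⟨ split k e ⟨
      suc k * 2 + e + 2               ≡⟨ cong (_+ 2) eq ⟩
      n + 2                           ≡⟨ m≡m%n+[m/n]*n (n + 2) 3 ⟩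
      (n + 2) % 3 + q * 3             <⟨ ℕ.+-monoˡ-< (q * 3) (m%n<n (n + 2) 3) ⟩
      suc q * 3                       ≤⟨ ℕ.*-monoˡ-≤ 3 (s≤s q≤k) ⟩
      suc k * 3                       ≡⟨ triple k ⟩
      suc k * 2 + suc k               ∎))
      where open ℕ.≤-Reasoning

    rise-before : ∀ {i} → i ≤ q → 2 * a n i < 2 * a n (suc i)
    rise-before {zero}  _   = first-rise
    rise-before {suc k} k<q
      with e , eq ← ℕ.m≤n⇒∃[o]m+o≡n (ℕ.≤-trans (ℕ.*-monoˡ-≤ 2 k<q) q*2≤n) =
      subst (λ n → 2 * a n (suc k) < 2 * a n (2 + k)) eq
        (rise-if k e (rises k e (before-peak eq k<q)
          (s≤s⁻¹ (s≤s⁻¹ (subst (8 ≤_) (sym eq) 8≤n)))))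

    fall-after : ∀ {k} → suc k ≤ n / 2 → q ≤ k → 2 * a n (2 + k) < 2 * a n (suc k)
    fall-after {k} k<n/2 q≤k
      with e , eq ← ℕ.m≤n⇒∃[o]m+o≡n (ℕ.≤-trans (ℕ.*-monoˡ-≤ 2 k<n/2) (m/n*n≤m n 2))
      with t , refl ← ℕ.m≤n⇒∃[o]m+o≡n (after-peak eq q≤k) =
      subst (λ n → 2 * a n (2 + k) < 2 * a n (suc k)) eq (fall-if k e (falls e t))

  strictPeak-large : StrictPeak (λ i → 2 * a n i) (suc q) (suc (n / 2))
  strictPeak-large =
    s≤s (subst (_≤ n / 2) (m*n/n≡m q 2) (/-monoˡ-≤ 2 q*2≤n)) ,
    (λ { (s≤s i≤q) → rise-before i≤q }) ,
    (λ { (s≤s i≤n/2) (s≤s q≤k) → fall-after i≤n/2 q≤k })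

strictPeak : ∀ n .{{_ : NonZero n}} → StrictPeak (λ i → 2 * a n i) (peakRL n) (suc (n / 2))
-- Evaluation covers n ≤ 7, where the formula for large n would give 2, 2, 2, 3, 3, 3, 4 in place of
-- 1, 1, 2, 2, 3, 3, 3.
strictPeak 1 = toWitness {a? = strictPeak? (λ i → 2 * a 1 i) 1 1} _
strictPeak 2 = toWitness {a? = strictPeak? (λ i → 2 * a 2 i) 1 2} _
strictPeak 3 = toWitness {a? = strictPeak? (λ i → 2 * a 3 i) 2 2} _
strictPeak 4 = toWitness {a? = strictPeak? (λ i → 2 * a 4 i) 2 3} _
strictPeak 5 = toWitness {a? = strictPeak? (λ i → 2 * a 5 i) 3 3} _
strictPeak 6 = toWitness {a? = strictPeak? (λ i → 2 * a 6 i) 3 4} _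
strictPeak 7 = toWitness {a? = strictPeak? (λ i → 2 * a 7 i) 3 4} _
strictPeak n@(suc (suc (suc (suc (suc (suc (suc (suc k)))))))) =
  subst (λ p → StrictPeak (λ i → 2 * a n i) p (suc (n / 2))) (ℕ.+-comm 1 ((n + 2) / 3))
    (strictPeak-large n (ℕ.m≤m+n 8 k))

-- Stated for any `f` pointwise equal to 2 a_n, so that the argument never looks inside
-- `genusCount`.
unimodal-with-peak : ∀ n .{{_ : NonZero n}} {f : ℕ → ℕ} → (∀ i → f i ≡ 2 * a n i) →
  ∃₂ λ γ γM → (0 < f γ × (∀ i → 0 < f i → γ ≤ i)) × (0 < f γM × (∀ i → 0 < f i → i ≤ γM)) ×
    Unimodal f γ γM × IsPeak f γ γM (peakRL n)
unimodal-with-peak n f≗2a = 0 , suc (n / 2) ,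
  (subst (0 <_) (sym (f≗2a 0)) (0<2a-zero n) , λ _ _ → z≤n) ,
  (subst (0 <_) (sym (f≗2a (suc (n / 2)))) (0<2a-maximum n) ,
    λ i 0<f → 0<2a⇒≤ n i (subst (0 <_) (f≗2a i) 0<f)) ,
  (_ , _ , peak) , peak
  where
  peak = strictPeak⇒isPeak (strictPeak-cong (λ i → sym (f≗2a i)) (strictPeak n))

corollary4p7 : (n : ℕ) .{{_ : NonZero n}} →
    ∃₂ λ (γ γM : ℕ) →
      IsMinimumGenus (RL n) γ × IsMaximumGenus (RL n) γM ×
      Unimodal (genusCount (RL n)) γ γM ×
      IsPeak (genusCount (RL n)) γ γM (peakRL n)
corollary4p7 n = unimodal-with-peak n {f = genusCount (RL n)} (genusCount-RL n)
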